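{- For every positive integer $n$, the number of permutation tableaux $T$ of length $n$ with $\mathrm{inv}(T)=0$ equals the Bell number $B_n$ (the number of set partitions of $[n]$).
   Context: A permutation tableau of length $n$ is a Ferrers diagram (left-justified rows of weakly decreasing length from top to bottom; rows of length $0$ are allowed, and every column is nonempty) with $r$ rows and $c$ columns, $r+c=n$, whose cells are filled with $0$'s and $1$'s such that (i) each column contains at least one $1$, and (ii) there is no $0$ that has a $1$ above it in its column and a $1$ to its left in its row. The boundary path from the top-right corner to the bottom-left corner consists of $n$ unit steps labeled $1,\ldots,n$ in order; a vertical step gives its row its label, a horizontal step gives its column its label. $(i,j)$ is the cell in row labeled $i$ and column labeled $j$. A larger row label means a lower row; a larger column label means a column further left. A $0$ is restricted if there is a $1$ above it in its column. A row is unrestricted if it contains no restricted $0$. The topmost $1$ of each column is a black dot, labeled by its column label; in each row containing a restricted $0$, the rightmost restricted $0$ is a white dot, labeled by its row label. The alternating path starting at a dot $d$ is the sequence of dots $d=d_1,d_2,\ldots$ with: if $d_m$ is a white dot in column $j$, $d_{m+1}$ is the black dot of column $j$; if $d_m$ is a black dot in a row $i$ that is not unrestricted, $d_{m+1}$ is the white dot of row $i$; if $d_m$ is a black dot in an unrestricted row, the path ends. $P_k$ is the path starting at the dot labeled $k$. A path $P$ contains $Q$ if $Q$ is a (final) segment of $P$. Order: for paths $P,Q$ neither containing the other: if they have no common dot, $P>Q$ if the ending dot of $P$ is in a lower row than that of $Q$, or in the same row and to the right of it, and $P<Q$ otherwise. If they share a dot, they coincide from the first common dot on; deleting the common dots gives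 $P',Q'$, and $P>Q$ if the ending dot of $P'$ is below or to the right of the ending dot of $Q'$, and $P<Q$ otherwise. Inversions: for a column label $j$ and a label $k>j$ of a dot such that $k$ is not the label of a dot on $P_j$, $(j,k)$ is an inversion of $T$ if $P_j>P_k$; $\mathrm{inv}(T)$ is the number of inversions of $T$. -}

module Defs where

open import Data.Bool using (Bool; true; false; _∧_; _∨_; not; if_then_else_)
open import Data.Nat using (ℕ; zero; suc; _<ᵇ_; _≡ᵇ_; _∸_)
open import Data.Fin using (Fin; toℕ)
open import Data.List using (List; []; _∷_; map; filterᵇ; length; concatMap;
  allFin; findᵇ; takeWhileᵇ; last; drop)
open import Data.Vec using (Vec; lookup) renaming ([] to []ᵛ; _∷_ to _∷ᵛ_)
open import Data.Maybe using (Maybe; just; nothing; is-just; maybe)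
open import Data.Product using (_×_; _,_; proj₁; proj₂)

-- Conventions.  Labels 1,…,n of the paper are represented 0-based by
-- Fin n (label k+1 of the paper is k here); only the relative order of
-- labels matters.  A candidate diagram of length n is a pair (s , A):
--   * s : Vec Bool n — the boundary path; step k is vertical (a row,
--     `true`) or horizontal (a column, `false`);
--   * A : Vec (Vec Bool n) n — A[i][j] is the entry of cell (i , j)
--     (true = 1, false = 0).  Entries outside the diagram must be 0,
--     so each tableau has exactly one representation.
-- Cell (i , j) exists iff i is a row label, j a column label and i < j
-- (the column with label j lies to the left of the right end of row i).

anyL : {X : Set} → (X → Bool) → List X → Bool
anyL p []       = false
anyL p (x ∷ xs) = p x ∨ anyL p xs

allL : {X : Set} → (X → Bool) → List X → Bool
allL p []       = true
allL p (x ∷ xs) = p x ∧ allL p xs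

allVecs : {X : Set} → List X → (n : ℕ) → List (Vec X n)
allVecs xs zero    = []ᵛ ∷ []
allVecs xs (suc n) = concatMap (λ x → map (x ∷ᵛ_) (allVecs xs n)) xs

Candidate : ℕ → Set
Candidate n = Vec Bool n × Vec (Vec Bool n) n

candidates : (n : ℕ) → List (Candidate n)
candidates n =
  concatMap (λ s → map (s ,_) (allVecs (allVecs (true ∷ false ∷ []) n) n))
            (allVecs (true ∷ false ∷ []) n)

module Tableau {n : ℕ} (s : Vec Bool n) (A : Vec (Vec Bool n) n) where

  _<F_ : Fin n → Fin n → Bool
  i <F j = toℕ i <ᵇ toℕ j

  _==F_ : Fin n → Fin n → Bool
  i ==F j = toℕ i ≡ᵇ toℕ j

  existsL : (Fin n → Bool) → Bool
  existsL p = anyL p (allFin n)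

  forallL : (Fin n → Bool) → Bool
  forallL p = allL p (allFin n)

  isRow : Fin n → Bool
  isRow i = lookup s i

  isCol : Fin n → Bool
  isCol j = not (isRow j)

  isCell : Fin n → Fin n → Bool
  isCell i j = isRow i ∧ isCol j ∧ (i <F j)

  entry : Fin n → Fin n → Bool
  entry i j = lookup (lookup A i) j

  one : Fin n → Fin n → Bool
  one i j = isCell i j ∧ entry i j

  zer : Fin n → Fin n → Bool
  zer i j = isCell i j ∧ not (entry i j)

  oneAbove : Fin n → Fin n → Bool
  oneAbove i j = existsL (λ i' → (i' <F i) ∧ one i' j)

  oneLeft : Fin n → Fin n → Bool
  oneLeft i j = existsL (λ j' → (j <F j') ∧ one i j')

  noJunk : Bool
  noJunk = forallL (λ i → forallL (λ j → isCell i j ∨ not (entry i j)))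

  columnsNonempty : Bool
  columnsNonempty = forallL (λ j → not (isCol j) ∨ existsL (λ i → isCell i j))

  conditionI : Bool
  conditionI = forallL (λ j → not (isCol j) ∨ existsL (λ i → one i j))

  conditionII : Bool
  conditionII = forallL (λ i → forallL (λ j →
                  not (zer i j ∧ oneAbove i j ∧ oneLeft i j)))

  isPermTableau : Bool
  isPermTableau = noJunk ∧ columnsNonempty ∧ conditionI ∧ conditionII

  restricted : Fin n → Fin n → Bool
  restricted i j = zer i j ∧ oneAbove i j

  unrestrictedRow : Fin n → Bool
  unrestrictedRow i = isRow i ∧ forallL (λ j → not (restricted i j))

  -- row of the black dot (topmost 1) of column j
  topRow : Fin n → Maybe (Fin n)
  topRow j = findᵇ (λ i → one i j) (allFin n)

  -- column of the white dot (rightmost = smallest column label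
  -- restricted 0) of row i
  whiteCol : Fin n → Maybe (Fin n)
  whiteCol i = findᵇ (λ j → restricted i j) (allFin n)

  -- position (row , column) of the dot labelled k, if there is one:
  -- a column label k labels the black dot of column k, a row label k
  -- labels the white dot of row k
  dotPos : Fin n → Maybe (Fin n × Fin n)
  dotPos k = if isRow k
             then maybe (λ j → just (k , j)) nothing (whiteCol k)
             else maybe (λ i → just (i , k)) nothing (topRow k)

  isDot : Fin n → Bool
  isDot k = is-just (dotPos k)

  next : Fin n → Maybe (Fin n)
  next k = if isRow k
           then whiteCol k          -- white dot in column j ↦ black dot j
           else maybe (λ i → if unrestrictedRow i then nothing else just i)
                      nothing (topRow k)

  -- the path, computed with fuel; along a path the row of the dots
  -- strictly decreases every two steps, so its dots are distinct and it
  -- has at most n dots: fuel n suffices.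
  pathF : ℕ → Fin n → List (Fin n)
  pathF zero    k = k ∷ []
  pathF (suc f) k = k ∷ maybe (pathF f) [] (next k)

  P : Fin n → List (Fin n)
  P k = pathF n k

  elemL : Fin n → List (Fin n) → Bool
  elemL k xs = anyL (λ x → x ==F k) xs

  eqL : List (Fin n) → List (Fin n) → Bool
  eqL []       []       = true
  eqL (x ∷ xs) (y ∷ ys) = (x ==F y) ∧ eqL xs ys
  eqL _        _        = false

  contains : List (Fin n) → List (Fin n) → Bool
  contains p q = eqL q (drop (length p ∸ length q) p)

  endPos : List (Fin n) → Maybe (Fin n × Fin n)
  endPos p = maybe dotPos nothing (last p)

  greaterDisjoint : List (Fin n) → List (Fin n) → Bool
  greaterDisjoint p q with endPos p | endPos q
  ... | just (rp , cp) | just (rq , cq) = (rq <F rp) ∨ ((rp ==F rq) ∧ (cp <F cq))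
  ... | _ | _ = false

  -- common dot: delete the common dots, P' ends below or to the right of Q'
  greaterShared : List (Fin n) → List (Fin n) → Bool
  greaterShared p q with endPos (takeWhileᵇ (λ x → not (elemL x q)) p)
                       | endPos (takeWhileᵇ (λ x → not (elemL x p)) q)
  ... | just (rp , cp) | just (rq , cq) = (rq <F rp) ∨ (cp <F cq)
  ... | _ | _ = false

  -- P > Q (only defined / true when neither path contains the other)
  greater : List (Fin n) → List (Fin n) → Bool
  greater p q =
    not (contains p q) ∧ not (contains q p) ∧
    (if anyL (λ x → elemL x q) p then greaterShared p q else greaterDisjoint p q)

  isInversion : Fin n → Fin n → Bool
  isInversion j k = isCol j ∧ (j <F k) ∧ isDot k ∧ not (elemL k (P j))
                    ∧ greater (P j) (P k)

  inv : ℕ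
  inv = length (concatMap (λ j → filterᵇ (λ k → isInversion j k) (allFin n))
                          (allFin n))

numPermTableauxInv0 : ℕ → ℕ
numPermTableauxInv0 n =
  length (filterᵇ (λ c → Tableau.isPermTableau (proj₁ c) (proj₂ c)
                         ∧ (Tableau.inv (proj₁ c) (proj₂ c) ≡ᵇ 0))
                  (candidates n))

numPermTableaux : ℕ → ℕ
numPermTableaux n =
  length (filterᵇ (λ c → Tableau.isPermTableau (proj₁ c) (proj₂ c)) (candidates n))

-- Bell numbers: the number of set partitions of an n-element set,
-- counted as the number of equivalence relations on Fin n (a relation
-- is an n×n Boolean matrix R; R[i][j] = "i and j in the same block").

isEquivalence : {n : ℕ} → Vec (Vec Bool n) n → Bool
isEquivalence {n} R =
  allL (λ i → rel i i) (allFin n) ∧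
  allL (λ i → allL (λ j → not (rel i j) ∨ rel j i) (allFin n)) (allFin n) ∧
  allL (λ i → allL (λ j → allL (λ k → not (rel i j ∧ rel j k) ∨ rel i k)
        (allFin n)) (allFin n)) (allFin n)
  where
  rel : Fin n → Fin n → Bool
  rel i j = lookup (lookup R i) j

bell : ℕ → ℕ
bell n = length (filterᵇ isEquivalence
                  (allVecs (allVecs (true ∷ false ∷ []) n) n))

{-# OPTIONS --safe #-}

-- A tableau has no inversion iff (a) distinct columns have distinct top rows (rows of their black
-- dots) and (b) whenever column x lies to the right of column y but has the lower top row r, row r
-- contains a restricted 0 in column y or to the right of it.  On paths this says that the black
-- dots after that of column x are the successive next columns to the left with a higher top row.
--
-- Such tableaux correspond to set partitions: column k is the maximum of a block of size at least
-- two, its top row is the minimum of the block, and the remaining elements are the rows containing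
-- no black dot whose white dot lies in column k.
module Submission where

open import Defs
open import Data.Bool using (Bool; true; false; _∧_; _∨_; not; if_then_else_; T)
open import Data.Empty using (⊥; ⊥-elim)
open import Data.Fin using (Fin; zero; suc; toℕ; _<_; _≤_; _>_)
open import Data.Fin.Induction using (>-wellFounded)
open import Data.Fin.Properties using (toℕ-injective; toℕ<n; <-cmp;
  <-trans; <-irrefl; <⇒≢; _<?_; _≤?_; _≟_; any?; all?)
open import Data.List using (List; []; _∷_; _++_; map; length; tabulate; allFin; findᵇ;
  takeWhileᵇ; filterᵇ; concatMap; cartesianProductWith; drop)
open import Data.List.Membership.Propositional using (_∈_; _∉_)
open import Data.List.Membership.Propositional.Properties
  using (∈-cartesianProductWith⁺; ∈-filter⁺; ∈-filter⁻; ∈-map⁺; ∈-map⁻)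
open import Data.List.Membership.Propositional.Properties.WithK using (unique∧set⇒bag)
open import Data.List.Properties using (length-map; map-id-local; map-∘)
open import Data.List.Relation.Binary.BagAndSetEquality using (∼bag⇒↭)
open import Data.List.Relation.Binary.Permutation.Propositional.Properties using (↭-length)
import Data.List.Relation.Unary.All as All
open import Data.List.Relation.Unary.All using ([]; _∷_)
open import Data.List.Relation.Unary.AllPairs using ([]; _∷_)
open import Data.List.Relation.Unary.Unique.Propositional using (Unique)
import Data.List.Relation.Unary.Unique.Propositional.Properties as Unique
open import Data.List.Relation.Unary.Any using (here; there)
open import Data.Maybe using (Maybe; just; nothing; maybe; is-just; fromMaybe)
open import Data.Maybe.Properties as Maybe using (just-injective)
open import Data.Nat as ℕ using (ℕ; zero; suc; _∸_; _≡ᵇ_)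
import Data.Nat.Properties as ℕₚ
open import Data.Product using (∃; _×_; _,_; proj₁; proj₂)
open import Data.Product.Properties using (,-injective)
open import Data.Sum using (_⊎_; inj₁; inj₂)
open import Data.Unit using (tt)
open import Data.Vec as Vec using (Vec; lookup)
open import Data.Vec.Properties using (lookup∘tabulate; tabulate∘lookup; tabulate-cong; ∷-injective)
open import Function using (_∘_; case_of_; _⟨_⟩_; _⇔_; mk⇔)
open import Induction.WellFounded using (Acc; acc)
open import Relation.Binary using (tri<; tri≈; tri>)
open import Relation.Binary.PropositionalEquality using (_≡_; _≢_; refl; sym; trans; cong; cong₂; subst; subst₂)
open import Relation.Nullary using (¬_; Dec; yes; no; does; proof)
open import Relation.Nullary.Decidable using (_×-dec_; _⊎-dec_; _→-dec_; ¬?; T?; decidable-stable)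
open import Relation.Nullary.Reflects

-- A comparison of paths is local. So a comparison is pushed forward until both paths end or step
-- into a common dot, and then only two dots are compared. The decisive configuration is a pair of
-- columns such that the white dot of each one's top row, if any, lies left of the other column: the
-- column with the lower top row then starts the greater path. If it is also the right one of the
-- two, there is an inversion; this is what forces (b). The filling is forced by the partition.
-- Cells above a topmost 1 are 0. In a row, the cells with a 1 above them are 1 up to the white dot
-- and 0 from there on, by condition (ii). The white dot of a non-minimal row lies in the column of
-- its block. The row of a minimum has a 1 in that column, and (b) makes it 0 in every column
-- further left whose top row is higher.

private
  variable
    X : Set
    n : ℕ
    b : Bool
    B C : Set

-- Boolean tests on finite types and the propositions they decide

sound : Reflects B b → T b → B
sound (ofʸ p) _ = p

complete : Reflects B b → B → T b
complete (ofʸ _)  _ = tt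
complete (ofⁿ ¬p) p = ¬p p

reflects-map : (B → C) → (C → B) → Reflects B b → Reflects C b
reflects-map to from (ofʸ p)  = ofʸ (to p)
reflects-map to from (ofⁿ ¬p) = ofⁿ (¬p ∘ from)

reflects-true : Reflects B b → B → b ≡ true
reflects-true (ofʸ _)  _ = refl
reflects-true (ofⁿ ¬p) p = ⊥-elim (¬p p)

reflects-false : Reflects B b → ¬ B → b ≡ false
reflects-false (ofʸ p) ¬p = ⊥-elim (¬p p)
reflects-false (ofⁿ _) _  = refl

if-true : {u v : X} → b ≡ true → (if b then u else v) ≡ u
if-true refl = refl

if-cong : {c : Bool} {u u′ v v′ : X} → b ≡ c → u ≡ u′ → v ≡ v′ →
  (if b then u else v) ≡ (if c then u′ else v′)
if-cong refl refl refl = refl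

if-false : {u v : X} → b ≡ false → (if b then u else v) ≡ v
if-false refl = refl

-- Stated for `tabulate f` because the tail of `allFin` is no longer an `allFin`; the induction
-- passes to `f ∘ suc`.
anyL-tabulate-reflects : {p : X → Bool} {Q : X → Set} → (∀ x → Reflects (Q x) (p x)) →
  (f : Fin n → X) → Reflects (∃ λ i → Q (f i)) (anyL p (tabulate f))
anyL-tabulate-reflects {n = zero}  r f = ofⁿ λ ()
anyL-tabulate-reflects {n = suc n} r f =
  reflects-map (λ { (inj₁ q) → zero , q ; (inj₂ (i , q)) → suc i , q })
               (λ { (zero , q) → inj₁ q ; (suc i , q) → inj₂ (i , q) })
               (r (f zero) ⊎-reflects anyL-tabulate-reflects r (f ∘ suc))

allL-tabulate-reflects : {p : X → Bool} {Q : X → Set} → (∀ x → Reflects (Q x) (p x)) →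
  (f : Fin n → X) → Reflects (∀ i → Q (f i)) (allL p (tabulate f))
allL-tabulate-reflects {n = zero}  r f = ofʸ λ ()
allL-tabulate-reflects {n = suc n} r f =
  reflects-map (λ { (q , qs) → λ { zero → q ; (suc i) → qs i } })
               (λ q → q zero , q ∘ suc)
               (r (f zero) ×-reflects allL-tabulate-reflects r (f ∘ suc))

anyL-reflects : {p : Fin n → Bool} {Q : Fin n → Set} →
  (∀ i → Reflects (Q i) (p i)) → Reflects (∃ Q) (anyL p (allFin n))
anyL-reflects r = anyL-tabulate-reflects r (λ i → i)

allL-reflects : {p : Fin n → Bool} {Q : Fin n → Set} →
  (∀ i → Reflects (Q i) (p i)) → Reflects (∀ i → Q i) (allL p (allFin n))
allL-reflects r = allL-tabulate-reflects r (λ i → i)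

-- Labels grow downwards and leftwards, so topmost 1's and rightmost restricted 0's are both least
-- witnesses.
data First (Q : Fin n → Set) : Maybe (Fin n) → Set where
  first : ∀ {i} → Q i → (∀ {j} → j < i → ¬ Q j) → First Q (just i)
  none  : (∀ {i} → ¬ Q i) → First Q nothing

find-first : {p : Fin n → Bool} {Q : Fin n → Set} →
  (∀ i → Reflects (Q i) (p i)) → First Q (findᵇ p (allFin n))
find-first {p = p} {Q} r = conclude (go (λ i → i))
  where
  Found : ∀ {m} → (Fin m → Fin _) → Set
  Found {m} f = (∃ λ i → findᵇ p (tabulate f) ≡ just (f i) × Q (f i) × (∀ {j} → j < i → ¬ Q (f j)))
              ⊎ (findᵇ p (tabulate f) ≡ nothing × (∀ {i} → ¬ Q (f i)))

  go : ∀ {m} (f : Fin m → Fin _) → Found f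
  go {zero}  f = inj₂ (refl , λ { {()} })
  go {suc m} f with p (f zero) | r (f zero) | go (f ∘ suc)
  ... | true  | ofʸ q  | _ = inj₁ (zero , refl , q , λ ())
  ... | false | ofⁿ ¬q | inj₁ (i , eq , q , least) =
        inj₁ (suc i , eq , q , λ { {zero} _ → ¬q ; {suc j} (ℕ.s≤s j<i) → least j<i })
  ... | false | ofⁿ ¬q | inj₂ (eq , all¬) =
        inj₂ (eq , λ { {zero} → ¬q ; {suc i} → all¬ })

  conclude : Found (λ i → i) → First Q (findᵇ p (allFin _))
  conclude (inj₁ (i , eq , q , least)) rewrite eq = first q least
  conclude (inj₂ (eq , all¬))          rewrite eq = none all¬

first-unique : {Q : Fin n → Set} {m m′ : Maybe (Fin n)} → First Q m → First Q m′ → m ≡ m′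
first-unique (first {i} q l) (first {j} q′ l′) with <-cmp i j
... | tri< i<j _ _ = ⊥-elim (l′ i<j q)
... | tri≈ _ refl _ = refl
... | tri> _ _ j<i = ⊥-elim (l j<i q′)
first-unique (first q _) (none ¬q)   = ⊥-elim (¬q q)
first-unique (none ¬q)   (first q _) = ⊥-elim (¬q q)
first-unique (none _)    (none _)    = refl

++-empty : ∀ (xs ys : List X) → (length (xs ++ ys) ≡ᵇ 0) ≡ (length xs ≡ᵇ 0) ∧ (length ys ≡ᵇ 0)
++-empty []       ys = refl
++-empty (x ∷ xs) ys = refl

filter-empty-reflects : (p : X → Bool) (f : Fin n → X) →
  Reflects (∀ i → ¬ T (p (f i))) (length (filterᵇ p (tabulate f)) ≡ᵇ 0)
filter-empty-reflects {n = zero}  p f = ofʸ λ ()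
filter-empty-reflects {n = suc n} p f with p (f zero) in eq
... | true  = ofⁿ λ all¬ → all¬ zero (subst T (sym eq) tt)
... | false = reflects-map (λ all¬ → λ { zero t → subst T eq t ; (suc i) → all¬ i }) (_∘ suc)
                           (filter-empty-reflects p (f ∘ suc))

concatMap-empty-reflects : {g : X → List X} {Q : X → Set} →
  (∀ x → Reflects (Q x) (length (g x) ≡ᵇ 0)) → (f : Fin n → X) →
  Reflects (∀ i → Q (f i)) (length (concatMap g (tabulate f)) ≡ᵇ 0)
concatMap-empty-reflects {n = zero}  r f = ofʸ λ ()
concatMap-empty-reflects {n = suc n} {g = g} {Q} r f =
  subst (Reflects _) (sym (++-empty (g (f zero)) _))
    (reflects-map (λ { (q , qs) → λ { zero → q ; (suc i) → qs i } }) (λ q → q zero , q ∘ suc)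
      (r (f zero) ×-reflects concatMap-empty-reflects {Q = Q} r (f ∘ suc)))

-- Tableaux and their dots as propositions

module Diagram {n : ℕ} (s : Vec Bool n) (A : Vec (Vec Bool n) n) where

  open Tableau s A public

  Row : Fin n → Set
  Row i = T (isRow i)

  Cell Entry One Zero OneAbove OneLeft Restricted : Fin n → Fin n → Set
  Cell i j       = Row i × ¬ Row j × i < j
  Entry i j      = T (entry i j)
  One i j        = Cell i j × Entry i j
  Zero i j       = Cell i j × ¬ Entry i j
  OneAbove i j   = ∃ λ i′ → i′ < i × One i′ j
  OneLeft i j    = ∃ λ j′ → j < j′ × One i j′
  Restricted i j = Zero i j × OneAbove i j

  Top White : Fin n → Fin n → Set
  Top j i   = topRow j ≡ just i
  White i j = whiteCol i ≡ just j

  row-reflects : ∀ i → Reflects (Row i) (isRow i)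
  row-reflects i = T-reflects (isRow i)

  <F-reflects : ∀ i j → Reflects (i < j) (i <F j)
  <F-reflects i j = ℕₚ.<ᵇ-reflects-< (toℕ i) (toℕ j)

  ==F-reflects : ∀ i j → Reflects (i ≡ j) (i ==F j)
  ==F-reflects i j = fromEquivalence (toℕ-injective ∘ ℕₚ.≡ᵇ⇒≡ (toℕ i) (toℕ j))
                                     (ℕₚ.≡⇒≡ᵇ (toℕ i) (toℕ j) ∘ cong toℕ)

  cell-reflects : ∀ i j → Reflects (Cell i j) (isCell i j)
  cell-reflects i j = row-reflects i ×-reflects ¬-reflects (row-reflects j) ×-reflects <F-reflects i j

  one-reflects : ∀ i j → Reflects (One i j) (one i j)
  one-reflects i j = cell-reflects i j ×-reflects T-reflects (entry i j)

  zero-reflects : ∀ i j → Reflects (Zero i j) (zer i j)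
  zero-reflects i j = cell-reflects i j ×-reflects ¬-reflects (T-reflects (entry i j))

  oneAbove-reflects : ∀ i j → Reflects (OneAbove i j) (oneAbove i j)
  oneAbove-reflects i j = anyL-reflects λ i′ → <F-reflects i′ i ×-reflects one-reflects i′ j

  oneLeft-reflects : ∀ i j → Reflects (OneLeft i j) (oneLeft i j)
  oneLeft-reflects i j = anyL-reflects λ j′ → <F-reflects j j′ ×-reflects one-reflects i j′

  restricted-reflects : ∀ i j → Reflects (Restricted i j) (restricted i j)
  restricted-reflects i j = zero-reflects i j ×-reflects oneAbove-reflects i j

  record Valid : Set where
    field
      no-junk     : ∀ {i j} → Entry i j → Cell i j
      column-one  : ∀ {j} → ¬ Row j → ∃ λ i → One i j
      condition-2 : ∀ {i j} → Zero i j → OneAbove i j → ¬ OneLeft i j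

  valid-reflects : Reflects Valid isPermTableau
  valid-reflects = reflects-map to from
    ( (allL-reflects λ i → allL-reflects λ j → cell-reflects i j ⊎-reflects ¬-reflects (T-reflects (entry i j)))
    ×-reflects (allL-reflects λ j → ¬-reflects (row-reflects j) →-reflects anyL-reflects λ i → cell-reflects i j)
    ×-reflects (allL-reflects λ j → ¬-reflects (row-reflects j) →-reflects anyL-reflects λ i → one-reflects i j)
    ×-reflects (allL-reflects λ i → allL-reflects λ j → ¬-reflects
         (zero-reflects i j ×-reflects oneAbove-reflects i j ×-reflects oneLeft-reflects i j)))
    where
    to : _ → Valid
    to (nj , _ , c1 , c2) = record
      { no-junk     = λ {i} {j} e → case nj i j of λ { (inj₁ c) → c ; (inj₂ ¬e) → ⊥-elim (¬e e) }
      ; column-one  = λ {j} → c1 j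
      ; condition-2 = λ {i} {j} z a l → c2 i j (z , a , l) }
    from : Valid → _
    from v = (λ i j → junk i j) , (λ j c → let i , o = column-one c in i , proj₁ o)
           , (λ j → column-one) , (λ i j (z , a , l) → condition-2 z a l)
      where
      open Valid v
      junk : ∀ i j → Cell i j ⊎ ¬ Entry i j
      junk i j with entry i j in eq
      ... | true  = inj₁ (no-junk (subst T (sym eq) tt))
      ... | false = inj₂ λ ()

  top-first : ∀ j → First (λ i → One i j) (topRow j)
  top-first j = find-first λ i → one-reflects i j

  white-first : ∀ i → First (Restricted i) (whiteCol i)
  white-first i = find-first (restricted-reflects i)

  top-intro : ∀ {j i} → One i j → (∀ {i′} → i′ < i → ¬ One i′ j) → Top j i
  top-intro {j} o l = first-unique (top-first j) (first o l)

  top-one : ∀ {j i} → Top j i → One i j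
  top-one {j} t with first o _ ← subst (First _) t (top-first j) = o

  top-least : ∀ {j i i′} → Top j i → i′ < i → ¬ One i′ j
  top-least {j} t with first _ l ← subst (First _) t (top-first j) = l

  white-intro : ∀ {i j} → Restricted i j → (∀ {j′} → j′ < j → ¬ Restricted i j′) → White i j
  white-intro {i} r l = first-unique (white-first i) (first r l)

  white-restricted : ∀ {i j} → White i j → Restricted i j
  white-restricted {i} w with first r _ ← subst (First _) w (white-first i) = r

  restricted⇒white : ∀ {i j} → Restricted i j → ∃ λ z → White i z × z ≤ j
  restricted⇒white {i} {j} r with whiteCol i in eq | white-first i
  ... | just z  | first _ l = z , refl , ℕₚ.≮⇒≥ λ j<z → l j<z r
  ... | nothing | none ¬r   = ⊥-elim (¬r r)

  nothing⇒unrestricted : ∀ {i j} → whiteCol i ≡ nothing → ¬ Restricted i j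
  nothing⇒unrestricted {i} w with none ¬r ← subst (First _) w (white-first i) = ¬r

  top-row : ∀ {j i} → Top j i → Row i
  top-row t = let (r , _) , _ = top-one t in r

  top-col : ∀ {j i} → Top j i → ¬ Row j
  top-col t = let (_ , c , _) , _ = top-one t in c

  top-< : ∀ {j i} → Top j i → i < j
  top-< t = let (_ , _ , l) , _ = top-one t in l

  white-row : ∀ {j i} → White i j → Row i
  white-row t = let ((r , _) , _) , _ = white-restricted t in r

  white-col : ∀ {j i} → White i j → ¬ Row j
  white-col t = let ((_ , c , _) , _) , _ = white-restricted t in c

  white-< : ∀ {j i} → White i j → i < j
  white-< t = let ((_ , _ , l) , _) , _ = white-restricted t in l

  one-unrestricted : ∀ {i j} → One i j → ¬ Restricted i j
  one-unrestricted (_ , e) ((_ , ¬e) , _) = ¬e e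

  restricted-top-< : ∀ {i j q} → Restricted i j → Top j q → q < i
  restricted-top-< (_ , i′ , i′<i , o) t = ℕₚ.≤-<-trans (ℕₚ.≮⇒≥ λ i′<q → top-least t i′<q o) i′<i

  unrestricted-reflects : ∀ r → Reflects (Row r × ∀ j → ¬ Restricted r j) (unrestrictedRow r)
  unrestricted-reflects r =
    row-reflects r ×-reflects allL-reflects λ j → ¬-reflects (restricted-reflects r j)

  next-row : ∀ {r} → Row r → next r ≡ whiteCol r
  next-row {r} ρ = if-true (reflects-true (row-reflects r) ρ)

  next-column : ∀ {x r} → Top x r → next x ≡ (if unrestrictedRow r then nothing else just r)
  next-column {x} t = trans (if-false (reflects-false (row-reflects x) (top-col t)))
                            (cong (maybe (λ i → if unrestrictedRow i then nothing else just i) nothing) t)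

  next-end : ∀ {x r} → Top x r → whiteCol r ≡ nothing → next x ≡ nothing
  next-end {x} {r} t w = trans (next-column t)
    (if-true (reflects-true (unrestricted-reflects r) (top-row t , λ j → nothing⇒unrestricted w)))

  next-top : ∀ {x r z} → Top x r → White r z → next x ≡ just r
  next-top {x} {r} {z} t w = trans (next-column t)
    (if-false (reflects-false (unrestricted-reflects r) λ (_ , u) → u z (white-restricted w)))

  dotPos-top : ∀ {x r} → Top x r → dotPos x ≡ just (r , x)
  dotPos-top {x} t = trans (if-false (reflects-false (row-reflects x) (top-col t)))
                           (cong (maybe (λ i → just (i , x)) nothing) t)

  dotPos-white : ∀ {r z} → White r z → dotPos r ≡ just (r , z)
  dotPos-white {r} w = trans (if-true (reflects-true (row-reflects r) (white-row w)))
                             (cong (maybe (λ j → just (r , j)) nothing) w)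

  isDot-dotPos : ∀ {k p} → dotPos k ≡ just p → T (isDot k)
  isDot-dotPos eq = subst (T ∘ is-just) (sym eq) tt

  -- Conditions (a) and (b). Smaller column labels lie further right, so `z ≤ y` means in column `y`
  -- or to its right.
  TopsInjective Nested : Set
  TopsInjective = ∀ {x y r} → Top x r → Top y r → x ≡ y
  Nested        = ∀ {x y r q} → Top x r → Top y q → x < y → q < r → ∃ λ z → White r z × z ≤ y

  -- Comparing paths as lists of labels

  elemL-reflects : ∀ k xs → Reflects (k ∈ xs) (elemL k xs)
  elemL-reflects k []       = ofⁿ λ ()
  elemL-reflects k (x ∷ xs) =
    reflects-map (λ { (inj₁ eq) → here (sym eq) ; (inj₂ m) → there m })
                 (λ { (here eq) → inj₁ (sym eq) ; (there m) → inj₂ m })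
                 (==F-reflects x k ⊎-reflects elemL-reflects k xs)

  elem-true : ∀ {k xs} → k ∈ xs → elemL k xs ≡ true
  elem-true {k} {xs} = reflects-true (elemL-reflects k xs)

  elem-false : ∀ {k xs} → k ∉ xs → elemL k xs ≡ false
  elem-false {k} {xs} = reflects-false (elemL-reflects k xs)

  elem-skip : ∀ {a x} p → x ≢ a → elemL x (a ∷ p) ≡ elemL x p
  elem-skip {a} {x} p x≢a = cong (_∨ elemL x p) (reflects-false (==F-reflects a x) (x≢a ∘ sym))

  eqL-sound : ∀ xs ys → eqL xs ys ≡ true → xs ≡ ys
  eqL-sound []       []       _ = refl
  eqL-sound (x ∷ xs) (y ∷ ys) e with x ==F y | ==F-reflects x y
  ... | true | ofʸ refl = cong (x ∷_) (eqL-sound xs ys e)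

  drop-∈ : ∀ m {x} (xs : List (Fin n)) → x ∈ drop m xs → x ∈ xs
  drop-∈ zero    xs       e = e
  drop-∈ (suc m) (_ ∷ xs) e = there (drop-∈ m xs e)

  -- The containment test compares `b ∷ q` with a final segment of `p`, all of whose members lie in
  -- `p`.
  contains-false : ∀ {b} p q → b ∉ p → contains p (b ∷ q) ≡ false
  contains-false {b} p q b∉p with contains p (b ∷ q) in eq
  ... | false = refl
  ... | true  = ⊥-elim (b∉p (drop-∈ (length p ∸ length (b ∷ q)) p
                  (subst (b ∈_) (eqL-sound _ _ eq) (here refl))))

  before : List (Fin n) → List (Fin n) → List (Fin n)
  before p q = takeWhileᵇ (λ x → not (elemL x q)) p

  meets : List (Fin n) → List (Fin n) → Bool
  meets p q = anyL (λ x → elemL x q) p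

  -- The end positions become arguments instead of being hidden in a `with`, so that equalities
  -- between positions can be substituted.
  sharedOrder disjointOrder : Maybe (Fin n × Fin n) → Maybe (Fin n × Fin n) → Bool
  sharedOrder (just (rp , cp)) (just (rq , cq)) = (rq <F rp) ∨ (cp <F cq)
  sharedOrder _                _                = false
  disjointOrder (just (rp , cp)) (just (rq , cq)) = (rq <F rp) ∨ ((rp ==F rq) ∧ (cp <F cq))
  disjointOrder _                _                = false

  order : List (Fin n) → List (Fin n) → Bool
  order p q = if meets p q then sharedOrder (endPos (before p q)) (endPos (before q p))
                           else disjointOrder (endPos p) (endPos q)

  order-cong : ∀ {p p′ q q′} → meets p q ≡ meets p′ q′ →
    endPos (before p q) ≡ endPos (before p′ q′) → endPos (before q p) ≡ endPos (before q′ p′) →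
    endPos p ≡ endPos p′ → endPos q ≡ endPos q′ → order p q ≡ order p′ q′
  order-cong m u v x y = if-cong m (cong₂ sharedOrder u v) (cong₂ disjointOrder x y)

  shared≡ : ∀ p q → greaterShared p q ≡ sharedOrder (endPos (before p q)) (endPos (before q p))
  shared≡ p q with endPos (before p q) | endPos (before q p)
  ... | just _  | just _  = refl
  ... | just _  | nothing = refl
  ... | nothing | _       = refl

  disjoint≡ : ∀ p q → greaterDisjoint p q ≡ disjointOrder (endPos p) (endPos q)
  disjoint≡ p q with endPos p | endPos q
  ... | just _  | just _  = refl
  ... | just _  | nothing = refl
  ... | nothing | _       = refl

  -- Each starting dot lies outside the other path, so both containment tests fail.
  greater≡order : ∀ {a b} p q → a ∉ b ∷ q → b ∉ a ∷ p → greater (a ∷ p) (b ∷ q) ≡ order (a ∷ p) (b ∷ q)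
  greater≡order {a} {b} p q a∉ b∉ = trans
    (cong₂ (λ u v → not u ∧ not v ∧ (if meets (a ∷ p) (b ∷ q) then greaterShared (a ∷ p) (b ∷ q)
                                                              else greaterDisjoint (a ∷ p) (b ∷ q)))
           (contains-false (a ∷ p) q b∉) (contains-false (b ∷ q) p a∉))
    (if-cong {b = meets (a ∷ p) (b ∷ q)} refl (shared≡ (a ∷ p) (b ∷ q)) (disjoint≡ (a ∷ p) (b ∷ q)))

  Inversion : Fin n → Fin n → Set
  Inversion j k = ¬ Row j × j < k × T (isDot k) × k ∉ P j × greater (P j) (P k) ≡ true

  inversion-reflects : ∀ j k → Reflects (Inversion j k) (isInversion j k)
  inversion-reflects j k = reflects-map
    (λ (c , l , d , e , g) → c , l , d , e , reflects-true (T-reflects _) g)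
    (λ (c , l , d , e , g) → c , l , d , e , subst T (sym g) tt)
    (¬-reflects (row-reflects j) ×-reflects <F-reflects j k ×-reflects T-reflects (isDot k)
      ×-reflects ¬-reflects (elemL-reflects k (P j)) ×-reflects T-reflects (greater (P j) (P k)))

  inv-reflects : Reflects (∀ j k → ¬ Inversion j k) (inv ≡ᵇ 0)
  inv-reflects = concatMap-empty-reflects {Q = λ j → ∀ k → ¬ Inversion j k}
    (λ j → reflects-map (λ all¬ k → all¬ k ∘ complete (inversion-reflects j k))
                        (λ all¬ k → all¬ k ∘ sound (inversion-reflects j k))
                        (filter-empty-reflects (isInversion j) (λ k → k))) (λ j → j)

  meets-skip : ∀ {a} p q → a ∉ q → meets q (a ∷ p) ≡ meets q p
  meets-skip p []      _   = refl
  meets-skip p (x ∷ q) a∉q =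
    cong₂ _∨_ (elem-skip p λ x≡a → a∉q (here (sym x≡a))) (meets-skip p q (a∉q ∘ there))

  before-skip : ∀ {a} p q → a ∉ q → before q (a ∷ p) ≡ before q p
  before-skip p []      _   = refl
  before-skip {a} p (x ∷ q) a∉q
    rewrite elem-skip {a} {x} p (λ x≡a → a∉q (here (sym x≡a))) with elemL x p
  ... | true  = refl
  ... | false = cong (x ∷_) (before-skip p q (a∉q ∘ there))

  before-∷ : ∀ {z} p q → z ∉ q → before (z ∷ p) q ≡ z ∷ before p q
  before-∷ p q z∉q rewrite elem-false z∉q = refl

  before-end : ∀ {c} p q → c ∈ q → before (c ∷ p) q ≡ []
  before-end p q c∈q rewrite elem-true c∈q = refl

  -- As `z ∉ q`, the private part of `z ∷ p` is nonempty, and its last dot stays last when `a` is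
  -- put in front.
  endPos-before : ∀ {a z} p q → a ∉ q → z ∉ q →
    endPos (before (a ∷ z ∷ p) q) ≡ endPos (before (z ∷ p) q)
  endPos-before {a} {z} p q a∉q z∉q = cong endPos (before-∷ (z ∷ p) q a∉q)
    ⟨ trans ⟩ cong (λ l → endPos (a ∷ l)) (before-∷ p q z∉q)
    ⟨ trans ⟩ cong endPos (sym (before-∷ p q z∉q))

  -- Dropping `a` changes neither whether the paths meet nor where they, or their private parts,
  -- end.
  order-stepˡ : ∀ {a z} p q → a ∉ q → z ∉ q → order (a ∷ z ∷ p) q ≡ order (z ∷ p) q
  order-stepˡ {a} {z} p q a∉q z∉q =
    order-cong {a ∷ z ∷ p} {z ∷ p} {q} {q} (cong (_∨ meets (z ∷ p) q) (elem-false a∉q))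
      (endPos-before p q a∉q z∉q) (cong endPos (before-skip (z ∷ p) q a∉q)) refl refl

  order-stepʳ : ∀ {a z} p q → a ∉ q → z ∉ q → order q (a ∷ z ∷ p) ≡ order q (z ∷ p)
  order-stepʳ {a} {z} p q a∉q z∉q =
    order-cong {q} {q} {a ∷ z ∷ p} {z ∷ p} (meets-skip (z ∷ p) q a∉q)
      (cong endPos (before-skip (z ∷ p) q a∉q)) (endPos-before p q a∉q z∉q) refl refl

  order-single : ∀ {a b} → a ≢ b → order (a ∷ []) (b ∷ []) ≡ disjointOrder (dotPos a) (dotPos b)
  order-single {a} {b} a≢b = if-false (cong (_∨ false) (elem-false {a} {b ∷ []} λ { (here e) → a≢b e }))

  -- Deleting the common dots, from `c` on, leaves the single dots `a` and `b`.
  order-meet : ∀ {a b c} t → a ∉ b ∷ c ∷ t → b ∉ a ∷ c ∷ t →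
    order (a ∷ c ∷ t) (b ∷ c ∷ t) ≡ sharedOrder (dotPos a) (dotPos b)
  order-meet {a} {b} {c} t a∉ b∉ =
    if-true (cong₂ (λ u v → u ∨ v ∨ meets t (b ∷ c ∷ t)) (elem-false a∉) (elem-true {c} {b ∷ c ∷ t} (there (here refl))))
    ⟨ trans ⟩ cong₂ (λ u v → sharedOrder (endPos u) (endPos v)) (stop a b a∉) (stop b a b∉)
    where
    stop : ∀ x y → x ∉ y ∷ c ∷ t → before (x ∷ c ∷ t) (y ∷ c ∷ t) ≡ x ∷ []
    stop x y x∉ = trans (before-∷ (c ∷ t) (y ∷ c ∷ t) x∉)
                        (cong (x ∷_) (before-end t (y ∷ c ∷ t) (there (here refl))))

-- Paths in a valid tableau

module Paths {n : ℕ} (s : Vec Bool n) (A : Vec (Vec Bool n) n) (valid : Diagram.Valid s A) where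

  open Diagram s A
  open Valid valid

  column-top : ∀ {j} → ¬ Row j → ∃ λ i → Top j i
  column-top {j} c with topRow j | top-first j
  ... | just i  | _       = i , refl
  ... | nothing | none ¬o = ⊥-elim (¬o (proj₂ (column-one c)))

  white? : ∀ r → whiteCol r ≡ nothing ⊎ ∃ (White r)
  white? r with whiteCol r
  ... | nothing = inj₁ refl
  ... | just z  = inj₂ (z , refl)

  white-unique : ∀ {i z z′} → White i z → White i z′ → z ≡ z′
  white-unique w w′ = just-injective (trans (sym w) w′)

  white-top : ∀ {r z} → White r z → ∃ λ q → Top z q × q < r
  white-top w = let q , t = column-top (white-col w) in q , t , restricted-top-< (white-restricted w) t

  -- By condition (ii) a restricted 0 has no 1 to its left.
  one-restricted-< : ∀ {i j k} → One i j → Restricted i k → j < k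
  one-restricted-< {i} {j} {k} o r@(z , a) with <-cmp j k
  ... | tri< j<k _ _  = j<k
  ... | tri≈ _ refl _ = ⊥-elim (one-unrestricted o r)
  ... | tri> _ _ k<j  = ⊥-elim (condition-2 z a (j , k<j , o))

  top-white-< : ∀ {x r z} → Top x r → White r z → x < z
  top-white-< t w = one-restricted-< (top-one t) (white-restricted w)

  pathF-suc : ∀ {f x m} → next x ≡ m → maybe (pathF f) [] m ≡ maybe (pathF (suc f)) [] m →
    pathF (suc f) x ≡ pathF (suc (suc f)) x
  pathF-suc {x = x} refl eq = cong (x ∷_) eq

  -- Along a path the column of the dots moves left or stays and their row moves up or stays,
  -- never both staying; so n + row − column bounds the number of dots that follow.
  stable-top : ∀ f {x r} → Top x r → n ℕ.+ toℕ r ℕ.≤ f ℕ.+ toℕ x → pathF f x ≡ pathF (suc f) x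
  stable-white : ∀ f {r z} → White r z → n ℕ.+ toℕ r ℕ.≤ f ℕ.+ toℕ z → pathF f r ≡ pathF (suc f) r
  stable-top zero {x} t le = ⊥-elim (ℕₚ.<⇒≱ (toℕ<n x) (ℕₚ.m+n≤o⇒m≤o n le))
  stable-top (suc f) {x} {r} t le with white? r
  ... | inj₁ w       = pathF-suc (next-end t w) refl
  ... | inj₂ (z , w) = pathF-suc (next-top t w) (stable-white f w
        (ℕₚ.≤-trans le (ℕₚ.≤-trans (ℕₚ.≤-reflexive (sym (ℕₚ.+-suc f (toℕ x)))) (ℕₚ.+-monoʳ-≤ f (top-white-< t w)))))
  stable-white zero {r} {z} w le = ⊥-elim (ℕₚ.<⇒≱ (toℕ<n z) (ℕₚ.m+n≤o⇒m≤o n le))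
  stable-white (suc f) {r} {z} w le with q , t , q<r ← white-top w =
    pathF-suc (trans (next-row (white-row w)) w) (stable-top f t
      (ℕ.s≤s⁻¹ (ℕₚ.≤-trans (ℕₚ.≤-reflexive (sym (ℕₚ.+-suc n (toℕ q)))) (ℕₚ.≤-trans (ℕₚ.+-monoʳ-≤ n q<r) le))))

  pathF-next-nothing : ∀ f {x} → next x ≡ nothing → pathF f x ≡ x ∷ []
  pathF-next-nothing zero    _  = refl
  pathF-next-nothing (suc f) {x} eq = cong (λ m → x ∷ maybe (pathF f) [] m) eq

  -- Fuel `n` is already stable, because the row label of a dot is smaller than its column label.
  -- From here on the fuel disappears.
  P-unfold : ∀ x → P x ≡ x ∷ maybe P [] (next x)
  P-unfold x = go (row-reflects x) (white? x)
    where
    go : ∀ {b} → Reflects (Row x) b → whiteCol x ≡ nothing ⊎ ∃ (White x) → pathF n x ≡ pathF (suc n) x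
    go (ofʸ ρ) (inj₁ w)       = let e = trans (next-row ρ) w in
      trans (pathF-next-nothing n e) (sym (pathF-next-nothing (suc n) e))
    go (ofʸ ρ) (inj₂ (z , w)) = stable-white n w (ℕₚ.+-monoʳ-≤ n (ℕₚ.<⇒≤ (white-< w)))
    go (ofⁿ c) _              = let r , t = column-top c in
      stable-top n t (ℕₚ.+-monoʳ-≤ n (ℕₚ.<⇒≤ (top-< t)))

  P-end : ∀ {x} → next x ≡ nothing → P x ≡ x ∷ []
  P-end {x} eq = trans (P-unfold x) (cong (λ m → x ∷ maybe P [] m) eq)

  P-step : ∀ {x z} → next x ≡ just z → P x ≡ x ∷ P z
  P-step {x} eq = trans (P-unfold x) (cong (λ m → x ∷ maybe P [] m) eq)

  P-column : ∀ {x r z} → Top x r → White r z → P x ≡ x ∷ r ∷ P z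
  P-column {x} t w = trans (P-step (next-top t w))
                           (cong (x ∷_) (P-step (trans (next-row (white-row w)) w)))

  P-white : ∀ {r z} → White r z → P r ≡ r ∷ P z
  P-white w = P-step (trans (next-row (white-row w)) w)

  start-∈ : ∀ x → x ∈ P x
  start-∈ x = subst (x ∈_) (sym (P-unfold x)) (here refl)

  later-∈ : ∀ {x y z} → next x ≡ just z → y ∈ P z → y ∈ P x
  later-∈ eq m = subst (_ ∈_) (sym (P-step eq)) (there m)

  ∈-column : ∀ {x r y} → Top x r → y ∈ P x → y ≡ x ⊎ ∃ λ z → White r z × (y ≡ r ⊎ y ∈ P z)
  ∈-column {x} {r} {y} t m with white? r
  ... | inj₁ w with here eq ← subst (y ∈_) (P-end (next-end t w)) m = inj₁ eq
  ... | inj₂ (z , w) with subst (y ∈_) (P-column t w) m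
  ...   | here eq         = inj₁ eq
  ...   | there (here eq) = inj₂ (z , w , inj₁ eq)
  ...   | there (there k) = inj₂ (z , w , inj₂ k)

  column-∈-column : ∀ {x r c} → Top x r → ¬ Row c → c ∈ P x → c ≡ x ⊎ ∃ λ z → White r z × c ∈ P z
  column-∈-column t ¬ρ m with ∈-column t m
  ... | inj₁ eq                = inj₁ eq
  ... | inj₂ (_ , _ , inj₁ eq) = ⊥-elim (¬ρ (subst Row (sym eq) (top-row t)))
  ... | inj₂ (z , w , inj₂ k)  = inj₂ (z , w , k)

  -- A white dot lies strictly left of the black dot before it, and the next black dot is in the
  -- same column as the white one.
  column-∈-≤ : ∀ {x c} → ¬ Row x → ¬ Row c → c ∈ P x → x ≤ c
  column-∈-≤ {x} {c} ¬ρ ¬σ = go (>-wellFounded x) (proj₂ (column-top ¬ρ))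
    where
    go : ∀ {x r} → Acc _>_ x → Top x r → c ∈ P x → x ≤ c
    go {x} (acc rec) t m with column-∈-column t ¬σ m
    ... | inj₁ refl        = ℕₚ.≤-refl
    ... | inj₂ (z , w , k) = let x<z = top-white-< t w in
          ℕₚ.≤-trans (ℕₚ.<⇒≤ x<z) (go (rec x<z) (proj₁ (proj₂ (white-top w))) k)

  -- A path that starts at a black dot reaches a white dot only from a black dot in the same row.
  row-∈-top : ∀ {x k} → ¬ Row x → Row k → k ∈ P x → ∃ λ c → Top c k × c ∈ P x
  row-∈-top {x} {k} ¬ρ ρ = go (>-wellFounded x) (proj₂ (column-top ¬ρ))
    where
    go : ∀ {x r} → Acc _>_ x → Top x r → k ∈ P x → ∃ λ c → Top c k × c ∈ P x
    go {x} (acc rec) t m with ∈-column t m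
    ... | inj₁ refl                  = ⊥-elim (top-col t ρ)
    ... | inj₂ (z , w , inj₁ refl)   = x , t , start-∈ x
    ... | inj₂ (z , w , inj₂ m′)     =
          let c , t′ , m″ = go (rec (top-white-< t w)) (proj₁ (proj₂ (white-top w))) m′
          in c , t′ , subst (c ∈_) (sym (P-column t w)) (there (there m″))

  greater≡order-P : ∀ {x y} → x ∉ P y → y ∉ P x → greater (P x) (P y) ≡ order (P x) (P y)
  greater≡order-P {x} {y} x∉ y∉ = subst₂ (λ p q → x ∉ q → y ∉ p → greater p q ≡ order p q)
    (sym (P-unfold x)) (sym (P-unfold y)) (greater≡order _ _) x∉ y∉

  order-P-stepˡ : ∀ {a z y} → next a ≡ just z → a ∉ P y → z ∉ P y → order (P a) (P y) ≡ order (P z) (P y)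
  order-P-stepˡ {a} {z} {y} eq a∉ z∉ = subst₂ (λ p q → order p (P y) ≡ order q (P y))
    (sym (trans (P-step eq) (cong (a ∷_) (P-unfold z)))) (sym (P-unfold z)) (order-stepˡ _ (P y) a∉ z∉)

  order-P-stepʳ : ∀ {a z y} → next a ≡ just z → a ∉ P y → z ∉ P y → order (P y) (P a) ≡ order (P y) (P z)
  order-P-stepʳ {a} {z} {y} eq a∉ z∉ = subst₂ (λ p q → order (P y) p ≡ order (P y) q)
    (sym (trans (P-step eq) (cong (a ∷_) (P-unfold z)))) (sym (P-unfold z)) (order-stepʳ _ (P y) a∉ z∉)

  greater-stepˡ : ∀ {a z y} → next a ≡ just z → a ∉ P y → z ∉ P y → y ∉ P a →
    greater (P a) (P y) ≡ greater (P z) (P y)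
  greater-stepˡ eq a∉ z∉ y∉ = greater≡order-P a∉ y∉
    ⟨ trans ⟩ order-P-stepˡ eq a∉ z∉ ⟨ trans ⟩ sym (greater≡order-P z∉ (y∉ ∘ later-∈ eq))

  greater-stepʳ : ∀ {a z y} → next a ≡ just z → a ∉ P y → z ∉ P y → y ∉ P a →
    greater (P y) (P a) ≡ greater (P y) (P z)
  greater-stepʳ eq a∉ z∉ y∉ = greater≡order-P y∉ a∉
    ⟨ trans ⟩ order-P-stepʳ eq a∉ z∉ ⟨ trans ⟩ sym (greater≡order-P (y∉ ∘ later-∈ eq) z∉)

  greater-columnˡ : ∀ {x r z y} → Top x r → White r z → x ∉ P y → r ∉ P y → z ∉ P y → y ∉ P x →
    greater (P x) (P y) ≡ greater (P z) (P y)
  greater-columnˡ t w x∉ r∉ z∉ y∉ =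
    trans (greater-stepˡ (next-top t w) x∉ r∉ y∉)
          (greater-stepˡ (trans (next-row (white-row w)) w) r∉ z∉ (y∉ ∘ later-∈ (next-top t w)))

  greater-columnʳ : ∀ {x r z y} → Top x r → White r z → x ∉ P y → r ∉ P y → z ∉ P y → y ∉ P x →
    greater (P y) (P x) ≡ greater (P y) (P z)
  greater-columnʳ t w x∉ r∉ z∉ y∉ =
    trans (greater-stepʳ (next-top t w) x∉ r∉ y∉)
          (greater-stepʳ (trans (next-row (white-row w)) w) r∉ z∉ (y∉ ∘ later-∈ (next-top t w)))

  greater-meet : ∀ {a b c} → next a ≡ just c → next b ≡ just c → a ∉ P b → b ∉ P a →
    greater (P a) (P b) ≡ sharedOrder (dotPos a) (dotPos b)
  greater-meet {a} {b} {c} ea eb a∉ b∉ = trans (greater≡order-P a∉ b∉)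
    (subst₂ (λ p q → a ∉ q → b ∉ p → order p q ≡ sharedOrder (dotPos a) (dotPos b))
      (sym (trans (P-step ea) (cong (a ∷_) (P-unfold c))))
      (sym (trans (P-step eb) (cong (b ∷_) (P-unfold c)))) (order-meet _) a∉ b∉)

  greater-end : ∀ {a b} → next a ≡ nothing → next b ≡ nothing → a ∉ P b → b ∉ P a →
    greater (P a) (P b) ≡ disjointOrder (dotPos a) (dotPos b)
  greater-end {a} {b} ea eb a∉ b∉ = trans (greater≡order-P a∉ b∉)
    (trans (cong₂ order (P-end ea) (P-end eb))
           (order-single λ a≡b → a∉ (subst (_∈ P b) (sym a≡b) (start-∈ b))))

  order-at-end : ∀ {x y r q} → Top x r → Top y q → whiteCol r ≡ nothing → whiteCol q ≡ nothing →
    x ∉ P y → y ∉ P x → greater (P x) (P y) ≡ disjointOrder (just (r , x)) (just (q , y))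
  order-at-end t u v w x∉ y∉ = trans (greater-end (next-end t v) (next-end u w) x∉ y∉)
    (cong₂ disjointOrder (dotPos-top t) (dotPos-top u))

  -- Once the two black dots are dropped, both white dots step into the black dot of column `z`, so
  -- they are compared with each other.
  order-at-meet : ∀ {x y r q z} → Top x r → Top y q → White r z → White q z →
    x ∉ P y → y ∉ P x → r ∉ P y → q ∉ P x →
    greater (P x) (P y) ≡ sharedOrder (just (r , z)) (just (q , z))
  order-at-meet t u v w x∉ y∉ r∉ q∉ =
    greater-stepˡ (next-top t v) x∉ r∉ y∉
    ⟨ trans ⟩ greater-stepʳ (next-top u w) (y∉ ∘ later-∈ (next-top t v)) (q∉ ∘ later-∈ (next-top t v)) r∉
    ⟨ trans ⟩ greater-meet (trans (next-row (white-row v)) v) (trans (next-row (white-row w)) w)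
                (r∉ ∘ later-∈ (next-top u w)) (q∉ ∘ later-∈ (next-top t v))
    ⟨ trans ⟩ cong₂ sharedOrder (dotPos-white v) (dotPos-white w)

  sharedOrder-reflects : ∀ r x q y →
    Reflects (q < r ⊎ x < y) (sharedOrder (just (r , x)) (just (q , y)))
  sharedOrder-reflects r x q y = <F-reflects q r ⊎-reflects <F-reflects x y

  disjointOrder-reflects : ∀ r x q y →
    Reflects (q < r ⊎ (r ≡ q × x < y)) (disjointOrder (just (r , x)) (just (q , y)))
  disjointOrder-reflects r x q y =
    <F-reflects q r ⊎-reflects ==F-reflects r q ×-reflects <F-reflects x y

  -- The columns visited after `y` begin with that of the white dot of row `q`, left of `x`, and
  -- only move left.
  column-∉ : ∀ {x y q} → ¬ Row x → Top y q → x ≢ y → (∀ {z} → White q z → x < z) → x ∉ P y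
  column-∉ c u x≢y x< m with column-∈-column u c m
  ... | inj₁ x≡y         = x≢y x≡y
  ... | inj₂ (z , w , k) = ℕₚ.<⇒≱ (x< w) (column-∈-≤ (white-col w) c k)

  smaller-∉ : ∀ {x y} → ¬ Row x → ¬ Row y → x < y → x ∉ P y
  smaller-∉ c d x<y m = ℕₚ.<⇒≱ x<y (column-∈-≤ d c m)

  -- Row `r` is entered only through a black dot in it, and `x` is the only one.
  top-∉ : ∀ {x y r} → TopsInjective → Top x r → ¬ Row y → x ∉ P y → r ∉ P y
  top-∉ {y = y} inj t c x∉ m = let _ , t′ , k = row-∈-top c (top-row t) m
                               in x∉ (subst (_∈ P y) (inj t′ t) k)

  -- Without inversions, top rows are distinct and nested

  module FromNoInversion (no-inversion : ∀ j k → ¬ Inversion j k) where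

    ¬greater : ∀ {x y} → ¬ Row x → ¬ Row y → x < y → y ∉ P x → greater (P x) (P y) ≢ true
    ¬greater c d x<y y∉ g = no-inversion _ _
      (c , x<y , isDot-dotPos (dotPos-top (proj₂ (column-top d))) , y∉ , g)

    -- Both paths end at once or step into the same white dot, so the two black dots are compared,
    -- and the right one wins.
    ¬shared-top : ∀ {x y r} → Top x r → Top y r → ¬ (x < y)
    ¬shared-top {x} {y} {r} t u x<y = ¬greater (top-col t) (top-col u) x<y y∉ g
      where
      y∉ : y ∉ P x
      y∉ = column-∉ (top-col u) t (λ y≡x → <⇒≢ x<y (sym y≡x)) (λ w → one-restricted-< (top-one u) (white-restricted w))
      x∉ : x ∉ P y
      x∉ = smaller-∉ (top-col t) (top-col u) x<y
      g : greater (P x) (P y) ≡ true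
      g with white? r
      ... | inj₁ w       = trans (order-at-end t u w w x∉ y∉)
                                 (reflects-true (disjointOrder-reflects r x r y) (inj₂ (refl , x<y)))
      ... | inj₂ (z , w) = trans (greater-meet (next-top t w) (next-top u w) x∉ y∉)
                                 (trans (cong₂ sharedOrder (dotPos-top t) (dotPos-top u))
                                        (reflects-true (sharedOrder-reflects r x r y) (inj₂ x<y)))

    tops-injective : TopsInjective
    tops-injective {x} {y} t u with <-cmp x y
    ... | tri< x<y _ _ = ⊥-elim (¬shared-top t u x<y)
    ... | tri≈ _ x≡y _ = x≡y
    ... | tri> _ _ y<x = ⊥-elim (¬shared-top u t y<x)

    -- Two columns whose top rows both stay unrestricted beyond the other column: following the
    -- two paths, the first one keeps the lower top row, since the move that would exchange them
    -- creates another such pair, hence an inversion.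
    lower-greater : ∀ f {x y r q} → n ℕ.+ n ℕ.≤ f ℕ.+ (toℕ x ℕ.+ toℕ y) → Top x r → Top y q → q < r →
      (∀ {z} → White r z → y < z) → (∀ {z} → White q z → x < z) → greater (P x) (P y) ≡ true
    -- Each move raises a column label, and two labels sum to less than `n + n`; so `f` bounds the
    -- remaining moves.
    lower-greater zero {x} {y} le _ _ _ _ _ =
      ⊥-elim (ℕₚ.<⇒≱ (ℕₚ.+-mono-< (toℕ<n x) (toℕ<n y)) le)
    lower-greater (suc f) {x} {y} {r} {q} le t u q<r y< x< = go (white? r) (white? q)
      where
      x≢y : x ≢ y
      x≢y refl = <-irrefl (just-injective (trans (sym u) t)) q<r
      x∉ = column-∉ (top-col t) u x≢y x<
      y∉ = column-∉ (top-col u) t (x≢y ∘ sym) y<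
      r∉ = top-∉ tops-injective t (top-col u) x∉
      q∉ = top-∉ tops-injective u (top-col t) y∉

      le-x : ∀ {z} → x < z → n ℕ.+ n ℕ.≤ f ℕ.+ (toℕ z ℕ.+ toℕ y)
      le-x x<z = ℕₚ.≤-trans le (ℕₚ.≤-trans (ℕₚ.≤-reflexive (sym (ℕₚ.+-suc f _)))
                   (ℕₚ.+-monoʳ-≤ f (ℕₚ.+-monoˡ-≤ (toℕ y) x<z)))

      le-y : ∀ {z} → y < z → n ℕ.+ n ℕ.≤ f ℕ.+ (toℕ x ℕ.+ toℕ z)
      le-y y<z = ℕₚ.≤-trans le (ℕₚ.≤-trans (ℕₚ.≤-reflexive (sym (ℕₚ.+-suc f _)))
                   (ℕₚ.+-monoʳ-≤ f (ℕₚ.≤-trans (ℕₚ.≤-reflexive (sym (ℕₚ.+-suc (toℕ x) (toℕ y))))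
                                                (ℕₚ.+-monoʳ-≤ (toℕ x) y<z))))

      advance-x : ∀ {z} → White r z → (∀ {z′} → White q z′ → z < z′) → greater (P x) (P y) ≡ true
      advance-x {z} w z< with p , t′ , p<r ← white-top w with <-cmp p q
      ... | tri≈ _ refl _ = ⊥-elim (<-irrefl (tops-injective u t′) (y< w))
      ... | tri> _ _ q<p  = trans
            (greater-columnˡ t w x∉ r∉ (column-∉ (top-col t′) u (λ z≡y → <⇒≢ (y< w) (sym z≡y)) z<) y∉)
            (lower-greater f (le-x (top-white-< t w)) t′ u q<p
              (λ w′ → <-trans (y< w) (top-white-< t′ w′)) z<)
      -- The roles are swapped: `y` is to the right of `z` and has the lower top row.
      ... | tri< p<q _ _  = ⊥-elim (¬greater (top-col u) (top-col t′) (y< w)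
            (column-∉ (top-col t′) u (λ z≡y → <⇒≢ (y< w) (sym z≡y)) z<)
            (lower-greater f (subst (λ m → n ℕ.+ n ℕ.≤ f ℕ.+ m) (ℕₚ.+-comm (toℕ z) (toℕ y)) (le-x (top-white-< t w)))
              u t′ p<q z< (λ w′ → <-trans (y< w) (top-white-< t′ w′))))

      advance-y : ∀ {z} → White q z → (∀ {z′} → White r z′ → z < z′) → greater (P x) (P y) ≡ true
      advance-y {z} w z< with p , u′ , p<q ← white-top w = trans
        (greater-columnʳ u w y∉ q∉ (column-∉ (top-col u′) t (λ z≡x → <⇒≢ (x< w) (sym z≡x)) z<) x∉)
        (lower-greater f (le-y (top-white-< u w)) t u′ (<-trans p<q q<r) z<
          (λ w′ → <-trans (x< w) (top-white-< u′ w′)))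

      go : whiteCol r ≡ nothing ⊎ ∃ (White r) → whiteCol q ≡ nothing ⊎ ∃ (White q) →
           greater (P x) (P y) ≡ true
      go (inj₁ v) (inj₁ w) = trans (order-at-end t u v w x∉ y∉)
                                   (reflects-true (disjointOrder-reflects r x q y) (inj₁ q<r))
      go (inj₁ v) (inj₂ (z′ , w)) = advance-y w λ v′ → case trans (sym v) v′ of λ ()
      go (inj₂ (z , v)) (inj₁ w)  = advance-x v λ w′ → case trans (sym w) w′ of λ ()
      -- The path whose white dot is further right moves, so the other white dot is still left of
      -- the column it reaches.
      go (inj₂ (z , v)) (inj₂ (z′ , w)) with <-cmp z z′
      ... | tri< z<z′ _ _ = advance-x v λ w′ → subst (z <_) (white-unique w w′) z<z′
      ... | tri> _ _ z′<z = advance-y w λ v′ → subst (z′ <_) (white-unique v v′) z′<z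
      ... | tri≈ _ refl _ = trans (order-at-meet t u v w x∉ y∉ r∉ q∉)
                                  (reflects-true (sharedOrder-reflects r z q z) (inj₁ q<r))

    -- The white dot of row `q`, if any, lies left of `y` and so of `x`; thus `lower-greater` makes
    -- the pair an inversion.
    ¬beyond : ∀ {x y r q} → Top x r → Top y q → x < y → q < r → ¬ (∀ {z} → White r z → y < z)
    ¬beyond t u x<y q<r y< = ¬greater (top-col t) (top-col u) x<y
      (column-∉ (top-col u) t (λ y≡x → <⇒≢ x<y (sym y≡x)) y<)
      (lower-greater (n ℕ.+ n) (ℕₚ.m≤m+n _ _) t u q<r y< (λ w → <-trans x<y (top-white-< u w)))

    nested : Nested
    nested {r = r} t u x<y q<r with white? r
    ... | inj₁ v       = ⊥-elim (¬beyond t u x<y q<r λ v′ → case trans (sym v) v′ of λ ())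
    ... | inj₂ (z , v) = z , v , ℕₚ.≮⇒≥ λ y<z → ¬beyond t u x<y q<r λ v′ → subst (_ <_) (white-unique v v′) y<z

  -- Distinct and nested top rows exclude inversions

  module FromNested (tops-injective : TopsInjective) (nested : Nested) where

    -- The path from `y` is followed. If it moved above row `r`, nesting would put the white dot of
    -- row `r` in the new column or to its right, against the invariant.
    higher-¬greater : ∀ {x y r q} → Top x r → Top y q → x < y → r < q → (∀ {z} → White r z → y < z) →
      greater (P x) (P y) ≡ false
    higher-¬greater {x} {y} t u = go (>-wellFounded y) t u
      where
      go : ∀ {x y r q} → Acc _>_ y → Top x r → Top y q → x < y → r < q → (∀ {z} → White r z → y < z) →
        greater (P x) (P y) ≡ false
      go {x} {y} {r} {q} (acc rec) t u x<y r<q y< = cases (white? r) (white? q)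
        where
        x∉ = smaller-∉ (top-col t) (top-col u) x<y
        y∉ = column-∉ (top-col u) t (λ y≡x → <⇒≢ x<y (sym y≡x)) y<
        r∉ = top-∉ tops-injective t (top-col u) x∉
        q∉ = top-∉ tops-injective u (top-col t) y∉

        advance : ∀ {z} → White q z → (∀ {z′} → White r z′ → z < z′) → greater (P x) (P y) ≡ false
        advance {z} w z< with p , u′ , p<q ← white-top w | x<z ← <-trans x<y (top-white-< u w) with <-cmp p r
        ... | tri≈ _ refl _ = ⊥-elim (<-irrefl (tops-injective t u′) x<z)
        ... | tri< p<r _ _  = let z′ , w′ , z′≤z = nested t u′ x<z p<r in ⊥-elim (ℕₚ.<⇒≱ (z< w′) z′≤z)
        ... | tri> _ _ r<p  = trans
              (greater-columnʳ u w y∉ q∉ (column-∉ (top-col u′) t (λ z≡x → <⇒≢ x<z (sym z≡x)) z<) x∉)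
              (go (rec (top-white-< u w)) t u′ x<z r<p z<)

        cases : whiteCol r ≡ nothing ⊎ ∃ (White r) → whiteCol q ≡ nothing ⊎ ∃ (White q) →
                greater (P x) (P y) ≡ false
        cases (inj₁ v) (inj₁ w) = trans (order-at-end t u v w x∉ y∉)
          (reflects-false (disjointOrder-reflects r x q y)
            λ { (inj₁ q<r) → ℕₚ.<-asym r<q q<r ; (inj₂ (refl , _)) → ℕₚ.<-irrefl refl r<q })
        cases (inj₁ v) (inj₂ (z′ , w)) = advance w λ v′ → case trans (sym v) v′ of λ ()
        -- Column `z` has a higher top row than `y`. So nesting gives row `q` a white dot no further
        -- left than `z`: the path from `y` moves, or the white dots share a column.
        cases (inj₂ (z , v)) _ with p , t′ , p<r ← white-top v
          with z′ , w , z′≤z ← nested u t′ (y< v) (<-trans p<r r<q)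
          with ℕₚ.m≤n⇒m<n∨m≡n z′≤z
        ... | inj₁ z′<z = advance w λ v′ → subst (z′ <_) (white-unique v v′) z′<z
        ... | inj₂ z′≡z with refl ← toℕ-injective z′≡z = trans (order-at-meet t u v w x∉ y∉ r∉ q∉)
          (reflects-false (sharedOrder-reflects r z q z)
            λ { (inj₁ q<r) → ℕₚ.<-asym r<q q<r ; (inj₂ z<z) → ℕₚ.<-irrefl refl z<z })

    -- The path from `x` moves until its next step would pass `y` or it ends; (a) and (b) then leave
    -- only the case of a top row higher than that of `y`.
    columns-¬greater : ∀ {x y} → ¬ Row x → ¬ Row y → x < y → y ∉ P x → greater (P x) (P y) ≡ false
    columns-¬greater {x} {y} c d = go (>-wellFounded x) (proj₂ (column-top c))
      where
      u = proj₂ (column-top d)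
      go : ∀ {x r} → Acc _>_ x → Top x r → x < y → y ∉ P x → greater (P x) (P y) ≡ false
      go {x} {r} (acc rec) t x<y y∉ = cases (white? r)
        where
        x∉ = smaller-∉ (top-col t) d x<y

        beyond : (∀ {z} → White r z → y < z) → greater (P x) (P y) ≡ false
        beyond y< with <-cmp r (proj₁ (column-top d))
        ... | tri< r<q _ _  = higher-¬greater t u x<y r<q y<
        ... | tri≈ _ refl _ = ⊥-elim (<-irrefl (tops-injective t u) x<y)
        ... | tri> _ _ q<r  = let z , w , z≤y = nested t u x<y q<r in ⊥-elim (ℕₚ.<⇒≱ (y< w) z≤y)

        cases : whiteCol r ≡ nothing ⊎ ∃ (White r) → greater (P x) (P y) ≡ false
        cases (inj₁ v) = beyond λ v′ → case trans (sym v) v′ of λ ()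
        cases (inj₂ (z , v)) with <-cmp z y
        ... | tri< z<y _ _  = trans
              (greater-columnˡ t v x∉ (top-∉ tops-injective t d x∉) (smaller-∉ (white-col v) d z<y) y∉)
              (go (rec (top-white-< t v)) (proj₁ (proj₂ (white-top v))) z<y λ m →
                y∉ (subst (y ∈_) (sym (P-column t v)) (there (there m))))
        ... | tri≈ _ refl _ = ⊥-elim (y∉ (subst (y ∈_) (sym (P-column t v)) (there (there (start-∈ y)))))
        ... | tri> _ _ y<z  = beyond λ v′ → subst (y <_) (white-unique v v′) y<z

    -- If `P j` reaches column `e`, it does so from a white dot in that column. This dot is above
    -- row `k`, since the path starts above `k` and rows only move up. Otherwise one step from `k`
    -- leaves two columns to compare.
    column-row-¬greater : ∀ {j k e} → ¬ Row j → j < k → White k e → k ∉ P j → greater (P j) (P k) ≡ false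
    column-row-¬greater {j} {k} {e} c j<k w k∉ = cases (elemL-reflects e (P j))
      where
      j<e : j < e
      j<e = <-trans j<k (white-< w)

      column-∉-row : ∀ {x} → ¬ Row x → x < e → x ∉ P k
      column-∉-row {x} ¬ρ x<e m with subst (x ∈_) (P-white w) m
      ... | here refl = ¬ρ (white-row w)
      ... | there m′  = smaller-∉ ¬ρ (white-col w) x<e m′

      go : ∀ {x r} → Acc _>_ x → Top x r → x < e → r < k → k ∉ P x → e ∈ P x → greater (P x) (P k) ≡ false
      go {x} {r} (acc rec) t x<e r<k k∉ e∈ with column-∈-column t (white-col w) e∈
      ... | inj₁ e≡x = ⊥-elim (<⇒≢ x<e (sym e≡x))
      ... | inj₂ (z , v , m) = conclude (ℕₚ.m≤n⇒m<n∨m≡n (column-∈-≤ (white-col v) (white-col w) m))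
        where
        x∉ = column-∉-row (top-col t) x<e
        r∉ : r ∉ P k
        r∉ m with subst (r ∈_) (P-white w) m
        ... | here refl = <-irrefl refl r<k
        ... | there m′  = top-∉ tops-injective t (white-col w) (smaller-∉ (top-col t) (white-col w) x<e) m′

        conclude : z < e ⊎ toℕ z ≡ toℕ e → greater (P x) (P k) ≡ false
        conclude (inj₁ z<e) = trans (greater-columnˡ t v x∉ r∉ (column-∉-row (white-col v) z<e) k∉)
          (go (rec (top-white-< t v)) (proj₁ (proj₂ (white-top v))) z<e
              (<-trans (proj₂ (proj₂ (white-top v))) r<k)
              (λ k∈ → k∉ (subst (k ∈_) (sym (P-column t v)) (there (there k∈)))) m)
        conclude (inj₂ z≡e) with refl ← toℕ-injective z≡e =
          greater-stepˡ (next-top t v) x∉ r∉ k∉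
          ⟨ trans ⟩ greater-meet (trans (next-row (white-row v)) v) (trans (next-row (white-row w)) w)
                      r∉ (k∉ ∘ later-∈ (next-top t v))
          ⟨ trans ⟩ cong₂ sharedOrder (dotPos-white v) (dotPos-white w)
          ⟨ trans ⟩ reflects-false (sharedOrder-reflects r z k z)
                      λ { (inj₁ k<r) → ℕₚ.<-asym r<k k<r ; (inj₂ z<z) → ℕₚ.<-irrefl refl z<z }

      cases : ∀ {b} → Reflects (e ∈ P j) b → greater (P j) (P k) ≡ false
      cases (ofʸ e∈) = let _ , t = column-top c in
        go (>-wellFounded j) t j<e (<-trans (top-< t) j<k) k∉ e∈
      cases (ofⁿ e∉) = trans
        (greater-stepʳ (trans (next-row (white-row w)) w) k∉ e∉ (column-∉-row c j<e))
        (columns-¬greater c (white-col w) j<e e∉)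

    no-inversion : ∀ j k → ¬ Inversion j k
    no-inversion j k (c , j<k , d , k∉ , g) = cases (row-reflects k) (white? k)
      where
      cases : ∀ {b} → Reflects (Row k) b → whiteCol k ≡ nothing ⊎ ∃ (White k) → ⊥
      cases (ofⁿ ¬ρ) _             = case trans (sym g) (columns-¬greater c ¬ρ j<k k∉) of λ ()
      cases (ofʸ ρ) (inj₂ (e , w)) = case trans (sym g) (column-row-¬greater c j<k w k∉) of λ ()
      -- A row without a restricted 0 has no white dot, so `k` labels no dot.
      cases (ofʸ ρ) (inj₁ w)       = subst (T ∘ is-just) (trans (if-true (reflects-true (row-reflects k) ρ))
        (cong (maybe (λ j → just (k , j)) nothing) w)) d

  inv0⇒ : T (inv ≡ᵇ 0) → TopsInjective × Nested
  inv0⇒ z = F.tops-injective , F.nested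
    where module F = FromNoInversion (sound inv-reflects z)

  inv0⇐ : TopsInjective → Nested → T (inv ≡ᵇ 0)
  inv0⇐ inj nest = complete inv-reflects (FromNested.no-inversion inj nest)

-- Boolean matrices as set partitions, and the filling each prescribes

lookup²-tabulate : (f : Fin n → Fin n → X) (i j : Fin n) →
  lookup (lookup (Vec.tabulate λ i → Vec.tabulate (f i)) i) j ≡ f i j
lookup²-tabulate f i j = trans (cong (λ v → lookup v j) (lookup∘tabulate (λ i → Vec.tabulate (f i)) i))
                               (lookup∘tabulate (f i) j)

tabulate²-lookup : (V : Vec (Vec X n) n) {f : Fin n → Fin n → X} →
  (∀ i j → lookup (lookup V i) j ≡ f i j) → V ≡ Vec.tabulate λ i → Vec.tabulate (f i)
tabulate²-lookup V eq = trans (sym (tabulate∘lookup V))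
  (tabulate-cong λ i → trans (sym (tabulate∘lookup (lookup V i))) (tabulate-cong (eq i)))

module Blocks {n : ℕ} (M : Vec (Vec Bool n) n) where

  Related : Fin n → Fin n → Set
  Related i j = T (lookup (lookup M i) j)

  related? : ∀ i j → Dec (Related i j)
  related? i j = T? (lookup (lookup M i) j)

  record Equivalence : Set where
    field
      reflexive  : ∀ i → Related i i
      symmetric  : ∀ {i j} → Related i j → Related j i
      transitive : ∀ {i j k} → Related i j → Related j k → Related i k

  equivalence-reflects : Reflects Equivalence (isEquivalence M)
  equivalence-reflects = reflects-map
    (λ (r , s , t) → record { reflexive = r ; symmetric = s _ _ ; transitive = λ u v → t _ _ _ (u , v) })
    (λ e → let open Equivalence e in reflexive , (λ _ _ → symmetric) , (λ _ _ _ (u , v) → transitive u v))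
    ( (allL-reflects λ i → R i i)
    ×-reflects (allL-reflects λ i → allL-reflects λ j → R i j →-reflects R j i)
    ×-reflects (allL-reflects λ i → allL-reflects λ j → allL-reflects λ k →
         (R i j ×-reflects R j k) →-reflects R i k))
    where
    R : ∀ i j → Reflects (Related i j) (lookup (lookup M i) j)
    R i j = T-reflects _

  -- Columns are the maxima of the non-singleton blocks; the topmost 1 of a column sits in the row
  -- of the minimum of its block, and below it a row has a 0 exactly when its own block has closed.
  Column : Fin n → Set
  Column k = (∃ λ i → i < k × Related i k) × (∀ j → Related k j → j ≤ k)

  Minimum Closed Filled : Fin n → Fin n → Set
  Minimum i k = Related i k × (∀ i′ → i′ < i → ¬ Related i′ k)
  Closed i k  = ∃ λ m → m ≤ k × Column m × Related i m
  Filled i k  = (¬ Column i × Column k × i < k) ×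
                (Minimum i k ⊎ ((∃ λ i′ → i′ < i × Related i′ k) × ¬ Closed i k))

  column? : ∀ k → Dec (Column k)
  column? k = any? (λ i → (i <? k) ×-dec related? i k) ×-dec all? (λ j → related? k j →-dec (j ≤? k))

  closed? : ∀ i k → Dec (Closed i k)
  closed? i k = any? λ m → (m ≤? k) ×-dec column? m ×-dec related? i m

  filled? : ∀ i k → Dec (Filled i k)
  filled? i k = (¬? (column? i) ×-dec column? k ×-dec (i <? k)) ×-dec
    ((related? i k ×-dec all? λ i′ → (i′ <? i) →-dec ¬? (related? i′ k))
      ⊎-dec (any? (λ i′ → (i′ <? i) ×-dec related? i′ k) ×-dec ¬? (closed? i k)))

  shape : Vec Bool n
  shape = Vec.tabulate λ k → does (¬? (column? k))

  filling : Vec (Vec Bool n) n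
  filling = Vec.tabulate λ i → Vec.tabulate λ k → does (filled? i k)

  module _ (s : Vec Bool n) (A : Vec (Vec Bool n) n) where

    open Diagram s A using (Row; Entry)

    -- Determines `s` and `A` completely, so it serves both to identify a given tableau with the
    -- constructed one and to reason about the latter without unfolding it.
    record Matches : Set where
      field
        row⇒   : ∀ {i} → Row i → ¬ Column i
        row⇐   : ∀ {i} → ¬ Column i → Row i
        entry⇒ : ∀ {i k} → Entry i k → Filled i k
        entry⇐ : ∀ {i k} → Filled i k → Entry i k

    matches⇒≡ : Matches → s ≡ shape × A ≡ filling
    matches⇒≡ m =
      trans (sym (tabulate∘lookup s))
        (tabulate-cong λ k → det (reflects-map row⇒ row⇐ (T-reflects _)) (proof (¬? (column? k)))) ,
      tabulate²-lookup A (λ i k → det (reflects-map entry⇒ entry⇐ (T-reflects _)) (proof (filled? i k)))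
      where open Matches m

  shape-filling-matches : Matches shape filling
  shape-filling-matches = record
    { row⇒   = sound (row _) ; row⇐   = complete (row _)
    ; entry⇒ = sound (ent _ _) ; entry⇐ = complete (ent _ _) }
    where
    row : ∀ k → Reflects (¬ Column k) (lookup shape k)
    row k = subst (Reflects _) (sym (lookup∘tabulate (λ k → does (¬? (column? k))) k)) (proof (¬? (column? k)))
    ent : ∀ i k → Reflects (Filled i k) (lookup (lookup filling i) k)
    ent i k = subst (Reflects _) (sym (lookup²-tabulate (λ i k → does (filled? i k)) i k)) (proof (filled? i k))

-- From tableaux to partitions

module Partition {n : ℕ} (s : Vec Bool n) (A : Vec (Vec Bool n) n) where

  open Diagram s A

  top? : ∀ i → Dec (∃ λ c → Top c i)
  top? i = any? λ c → Maybe.≡-dec _≟_ (topRow c) (just i)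

  -- Representative of the block: its column, or the row itself for a singleton. A black dot takes
  -- precedence, since the minimum of a block may also have a white dot, in a column of another
  -- block.
  block : Fin n → Fin n
  block i with top? i
  ... | yes (c , _) = c
  ... | no _        = fromMaybe i (whiteCol i)

  data BlockView (i : Fin n) : Fin n → Set where
    top   : ∀ {c} → Top c i → BlockView i c
    white : ∀ {c} → (∀ {c′} → ¬ Top c′ i) → White i c → BlockView i c
    alone : (∀ {c′} → ¬ Top c′ i) → whiteCol i ≡ nothing → BlockView i i

  blockView : ∀ i → BlockView i (block i)
  blockView i with top? i
  ... | yes (c , t) = top t
  ... | no ¬t with whiteCol i in eq
  ...   | just c  = white (λ t → ¬t (_ , t)) eq
  ...   | nothing = alone (λ t → ¬t (_ , t)) eq

  partition : Vec (Vec Bool n) n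
  partition = Vec.tabulate λ i → Vec.tabulate λ j → block i ==F block j

  open Blocks partition

  related-reflects : ∀ i j → Reflects (block i ≡ block j) (lookup (lookup partition i) j)
  related-reflects i j = subst (Reflects _) (sym (lookup²-tabulate (λ i j → block i ==F block j) i j))
                               (==F-reflects (block i) (block j))

  related⇒ : ∀ {i j} → Related i j → block i ≡ block j
  related⇒ = sound (related-reflects _ _)

  related⇐ : ∀ {i j} → block i ≡ block j → Related i j
  related⇐ = complete (related-reflects _ _)

  partition-equivalence : Equivalence
  partition-equivalence = record
    { reflexive  = λ i → related⇐ refl
    ; symmetric  = λ r → related⇐ (sym (related⇒ r))
    ; transitive = λ r r′ → related⇐ (trans (related⇒ r) (related⇒ r′)) }

  block-column : ∀ {k} → ¬ Row k → block k ≡ k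
  block-column {k} c with block k | blockView k
  ... | _ | top t     = ⊥-elim (c (top-row t))
  ... | _ | white _ w = ⊥-elim (c (white-row w))
  ... | _ | alone _ _ = refl

  block-top : ∀ {c i} → TopsInjective → Top c i → block i ≡ c
  block-top {i = i} inj t with block i | blockView i
  ... | _ | top t′     = inj t′ t
  ... | _ | white ¬t _ = ⊥-elim (¬t t)
  ... | _ | alone ¬t _ = ⊥-elim (¬t t)

  block-white : ∀ {c i} → (∀ {c′} → ¬ Top c′ i) → White i c → block i ≡ c
  block-white {i = i} ¬t w with block i | blockView i
  ... | _ | top t      = ⊥-elim (¬t t)
  ... | _ | white _ w′ = just-injective (trans (sym w′) w)
  ... | _ | alone _ eq = case trans (sym eq) w of λ ()

  block-alone : ∀ {i} → (∀ {c′} → ¬ Top c′ i) → whiteCol i ≡ nothing → block i ≡ i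
  block-alone {i} ¬t eq with block i | blockView i
  ... | _ | top t      = ⊥-elim (¬t t)
  ... | _ | white _ w  = case trans (sym eq) w of λ ()
  ... | _ | alone _ _  = refl

  module _ (valid : Valid) (inj : TopsInjective) (nested : Nested) where

    open Paths s A valid

    column⇒ : ∀ {k} → ¬ Row k → Column k
    column⇒ {k} c = let r , t = column-top c in
      (r , top-< t , related⇐ (trans (block-top inj t) (sym (block-column c)))) ,
      λ j e → largest j (trans (sym (related⇒ e)) (block-column c))
      where
      largest : ∀ j → block j ≡ k → j ≤ k
      largest j refl with block j | blockView j
      ... | _ | top t     = ℕₚ.<⇒≤ (top-< t)
      ... | _ | white _ w = ℕₚ.<⇒≤ (white-< w)
      ... | _ | alone _ _ = ℕₚ.≤-refl

    related-row : ∀ {i k} → ¬ Row k → Related i k → i ≢ k → Top k i ⊎ White i k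
    related-row {i} {k} c e i≢k = go (trans (related⇒ e) (block-column c))
      where
      go : block i ≡ k → Top k i ⊎ White i k
      go refl with block i | blockView i
      ... | _ | top t     = inj₁ t
      ... | _ | white _ w = inj₂ w
      ... | _ | alone _ _ = ⊥-elim (i≢k refl)

    -- A row with a dot is smaller than the column of its block. A row without one is alone, since
    -- any other element represented by it would make it a column.
    column⇐ : ∀ {k} → Column k → ¬ Row k
    column⇐ {k} ((i , i<k , e) , largest) ρ = go (block k) refl (blockView k)
      where
      go : ∀ b → block k ≡ b → BlockView k b → ⊥
      go b eq (top t)     = ℕₚ.<⇒≱ (top-< t) (largest b (related⇐ (trans eq (sym (block-column (top-col t))))))
      go b eq (white _ w) = ℕₚ.<⇒≱ (white-< w) (largest b (related⇐ (trans eq (sym (block-column (white-col w))))))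
      go _ eq (alone _ _) = single (block i) (trans (related⇒ e) eq) (blockView i)
        where
        single : ∀ b → b ≡ k → BlockView i b → ⊥
        single _ refl (top t)     = top-col t ρ
        single _ refl (white _ w) = white-col w ρ
        single _ refl (alone _ _) = <-irrefl refl i<k

    one⇒filled : ∀ {i k} → One i k → Filled i k
    one⇒filled {i} {k} o@((ρ , c , i<k) , _) with column-top c
    ... | r , t = ((λ d → column⇐ d ρ) , column⇒ c , i<k) , cases (<-cmp i r)
      where
      top-related : Related r k
      top-related = related⇐ (trans (block-top inj t) (sym (block-column c)))

      cases : _ → Minimum i k ⊎ ((∃ λ i′ → i′ < i × Related i′ k) × ¬ Closed i k)
      cases (tri< i<r _ _)  = ⊥-elim (top-least t i<r o)
      cases (tri≈ _ refl _) = inj₁ (top-related , least)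
        where
        least : ∀ i′ → i′ < i → ¬ Related i′ k
        least i′ i′<i e with related-row c e (<⇒≢ (<-trans i′<i i<k))
        ... | inj₁ t′ = <⇒≢ i′<i (just-injective (trans (sym t′) t))
        ... | inj₂ w  = ℕₚ.<-asym i′<i (restricted-top-< (white-restricted w) t)
      cases (tri> _ _ r<i)  = inj₂ ((r , r<i , top-related) , open-block)
        where
        -- Otherwise row `i` has a restricted 0 at or right of this 1: in column `m`, or by nesting
        -- if `i` is the top row of `m`. The case `m = k` contradicts that `r` is the top row.
        open-block : ¬ Closed i k
        open-block (m , m≤k , d , e) with related-row (column⇐ d) e (λ { refl → column⇐ d ρ })
        ... | inj₂ w = ℕₚ.<⇒≱ (one-restricted-< o (white-restricted w)) m≤k
        ... | inj₁ t′ with ℕₚ.m≤n⇒m<n∨m≡n m≤k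
        ...   | inj₁ m<k = let z , w , z≤k = nested t′ t m<k r<i
                           in ℕₚ.<⇒≱ (one-restricted-< o (white-restricted w)) z≤k
        ...   | inj₂ m≡k with refl ← toℕ-injective m≡k = <⇒≢ r<i (just-injective (trans (sym t) t′))

    filled⇒entry : ∀ {i k} → Filled i k → Entry i k
    filled⇒entry {i} {k} ((¬d , d , i<k) , f) = decidable-stable (T? (entry i k)) λ ¬e → absurd f ((ρ , c , i<k) , ¬e)
      where
      c : ¬ Row k
      c = column⇐ d
      ρ : Row i
      ρ = decidable-stable (T? (isRow i)) λ ¬ρ → ¬d (column⇒ ¬ρ)

      absurd : Minimum i k ⊎ ((∃ λ i′ → i′ < i × Related i′ k) × ¬ Closed i k) → Zero i k → ⊥
      absurd (inj₁ (e , least)) (_ , ¬e) with related-row c e (<⇒≢ i<k)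
      ... | inj₁ t = ¬e (proj₂ (top-one t))
      -- The top row of the column is a smaller member of the block.
      ... | inj₂ w = let r , t , r<i = white-top w in
            least r r<i (related⇐ (trans (block-top inj t) (sym (block-column c))))
      -- The 0 would be restricted, so row `i` has a white dot at or right of `k`. The column of its
      -- block is that of the white dot or, for a black dot, further right still.
      absurd (inj₂ ((i′ , i′<i , e) , ¬closed)) z =
        let w , v , w≤k = restricted⇒white (z , above) in closed (blockView i) refl v w≤k
        where
        above : OneAbove i k
        above with related-row c e (<⇒≢ (<-trans i′<i i<k))
        ... | inj₁ t = i′ , i′<i , top-one t
        ... | inj₂ w = let r , t , r<i′ = white-top w in r , <-trans r<i′ i′<i , top-one t

        closed : ∀ {b w} → BlockView i b → block i ≡ b → White i w → w ≤ k → ⊥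
        closed {b} (top t) eq v w≤k = ¬closed (b ,
          ℕₚ.≤-trans (ℕₚ.<⇒≤ (top-white-< t v)) w≤k , column⇒ (top-col t) ,
          related⇐ (trans eq (sym (block-column (top-col t)))))
        closed {b} (white _ v′) eq v w≤k = ¬closed (b ,
          subst (_≤ k) (white-unique v v′) w≤k , column⇒ (white-col v′) ,
          related⇐ (trans eq (sym (block-column (white-col v′)))))
        closed (alone _ eq) _ v _ = case trans (sym eq) v of λ ()

    partition-matches : Matches s A
    partition-matches = record
      { row⇒   = λ ρ d → column⇐ d ρ
      ; row⇐   = λ {i} ¬d → decidable-stable (T? (isRow i)) λ ¬ρ → ¬d (column⇒ ¬ρ)
      ; entry⇒ = λ e → one⇒filled (Valid.no-junk valid e , e)
      ; entry⇐ = filled⇒entry }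

-- From partitions to tableaux

module FromEquivalence {n : ℕ} (M : Vec (Vec Bool n) n) (equivalence : Blocks.Equivalence M)
  (s : Vec Bool n) (A : Vec (Vec Bool n) n) (matches : Blocks.Matches M s A) where

  open Blocks M
  open Equivalence equivalence
  open Matches matches
  open Diagram s A
  open Partition s A using (block; block-column; block-top; block-white; block-alone; partition)

  row⇒column : ∀ {k} → ¬ Row k → Column k
  row⇒column {k} c = decidable-stable (column? k) (c ∘ row⇐)

  filled⇒cell : ∀ {i k} → Filled i k → Cell i k
  filled⇒cell ((¬d , d , i<k) , _) = row⇐ ¬d , (λ ρ → row⇒ ρ d) , i<k

  filled⇒one : ∀ {i k} → Filled i k → One i k
  filled⇒one f = filled⇒cell f , entry⇐ f

  one⇒filled : ∀ {i k} → One i k → Filled i k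
  one⇒filled (_ , e) = entry⇒ e

  column-unique : ∀ {k l} → Column k → Column l → Related k l → k ≡ l
  column-unique (_ , k-max) (_ , l-max) r = toℕ-injective (ℕₚ.≤-antisym (l-max _ (symmetric r)) (k-max _ r))

  -- Climb to larger members until none is left; the smaller member at hand shows that the block is
  -- no singleton.
  column-above : ∀ {i j} → Related i j → i < j → ∃ λ c → Column c × Related j c
  column-above {j = j} = go (>-wellFounded j)
    where
    go : ∀ {i j} → Acc _>_ j → Related i j → i < j → ∃ λ c → Column c × Related j c
    go {i} {j} (acc rec) r i<j with any? (λ k → (j <? k) ×-dec related? j k)
    ... | yes (k , j<k , r′) = let c , d , r″ = go (rec j<k) r′ j<k in c , d , transitive r′ r″
    ... | no none-above      = j , ((i , i<j , r) , λ k r′ → ℕₚ.≮⇒≥ λ j<k → none-above (k , j<k , r′)) , reflexive j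

  minimum : ∀ k → ∃ λ i → Minimum i k
  minimum k = go (find-first {p = λ i → lookup (lookup M i) k} (λ i → T-reflects _))
    where
    go : ∀ {m} → First (λ i → Related i k) m → ∃ λ i → Minimum i k
    go (first r l) = _ , r , λ _ → l
    go (none ¬r)   = ⊥-elim (¬r (reflexive k))

  minimum-one : ∀ {i k} → Column k → Minimum i k → One i k
  minimum-one {i} {k} d@((j , j<k , r′) , _) m@(r , least) = filled⇒one ((¬d , d , i<k) , inj₁ m)
    where
    i<k : i < k
    i<k = ℕₚ.≤-<-trans (ℕₚ.≮⇒≥ λ j<i → least j j<i r′) j<k
    ¬d : ¬ Column i
    ¬d d′ = <⇒≢ i<k (column-unique d′ d r)

  minimum-top : ∀ {i k} → Column k → Minimum i k → Top k i
  minimum-top d m@(_ , least) = top-intro (minimum-one d m) λ {i′} i′<i o → case proj₂ (one⇒filled o) of λ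
    { (inj₁ (r , _))             → least i′ i′<i r
    ; (inj₂ ((j , j<i′ , r) , _)) → least j (<-trans j<i′ i′<i) r }

  top-minimum : ∀ {i k} → Top k i → Minimum i k
  top-minimum {i} {k} t =
    let i′ , m = minimum k
    in subst (λ x → Minimum x k) (just-injective (trans (sym (minimum-top (row⇒column (top-col t)) m)) t)) m

  -- The 1 above yields a smaller member of the block of `k`, after which `Filled` can fail only
  -- because the block of `i` has closed.
  zero-closed : ∀ {i k} → Zero i k → OneAbove i k → Closed i k
  zero-closed {i} {k} ((ρ , c , i<k) , ¬e) (i′ , i′<i , o) = decidable-stable (closed? i k) λ ¬closed →
    ¬e (entry⇐ ((row⇒ ρ , row⇒column c , i<k) , inj₂ (related-above (proj₂ (one⇒filled o)) , ¬closed)))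
    where
    related-above : Minimum i′ k ⊎ ((∃ λ j → j < i′ × Related j k) × ¬ Closed i′ k) →
                    ∃ λ j → j < i × Related j k
    related-above (inj₁ (r , _))              = i′ , i′<i , r
    related-above (inj₂ ((j , j<i′ , r) , _)) = j , <-trans j<i′ i′<i , r

  -- A closed block stays closed further left, and `i`, whose column is not `k`, is not the minimum
  -- of the block of `k`.
  one-¬closed : ∀ {i j k} → j < k → Closed i j → ¬ One i k
  one-¬closed j<k (m , m≤j , d , r) o with one⇒filled o
  ... | _ , inj₂ (_ , ¬closed)      = ¬closed (m , ℕₚ.≤-trans m≤j (ℕₚ.<⇒≤ j<k) , d , r)
  ... | (_ , d′ , _) , inj₁ (r′ , _) =
        <⇒≢ (ℕₚ.≤-<-trans m≤j j<k) (column-unique d d′ (transitive (symmetric r) r′))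

  valid : Valid
  valid = record
    { no-junk     = filled⇒cell ∘ entry⇒
    ; column-one  = λ {j} c → let i , m = minimum j in i , minimum-one (row⇒column c) m
    ; condition-2 = λ z a (k , j<k , o) → one-¬closed j<k (zero-closed z a) o }

  tops-injective : TopsInjective
  tops-injective t u = column-unique (row⇒column (top-col t)) (row⇒column (top-col u))
    (transitive (symmetric (proj₁ (top-minimum t))) (proj₁ (top-minimum u)))

  -- The block of `r` closes at `x`, so row `r` has a 0 in column `y`, below the 1 in row `q`.
  nested : Nested
  nested {x} {y} {r} {q} t u x<y q<r = restricted⇒white
    (((top-row t , top-col u , <-trans (top-< t) x<y) , ¬e) , q , q<r , top-one u)
    where
    ¬e : ¬ Entry r y
    ¬e e with entry⇒ e
    ... | _ , inj₁ (_ , least)   = least q q<r (proj₁ (top-minimum u))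
    ... | _ , inj₂ (_ , ¬closed) = ¬closed (x , ℕₚ.<⇒≤ x<y , row⇒column (top-col t) , proj₁ (top-minimum t))

  -- A member that is neither minimum nor maximum has a restricted 0 in column `k`, where the block
  -- closes. One further right would need the block to close earlier, so this is the white dot.
  related-block-column : ∀ {i k} → Column k → Related i k → block i ≡ k
  related-block-column {i} {k} d r with i ≟ k | minimum k
  ... | yes refl | _ = block-column λ ρ → row⇒ ρ d
  ... | no i≢k   | i₀ , m with i ≟ i₀
  ...   | yes refl = block-top tops-injective (minimum-top d m)
  ...   | no i≢i₀  = block-white ¬top (white-intro (((row⇐ ¬column , (λ ρ → row⇒ ρ d) , i<k) , ¬e) ,
                                                   i₀ , i₀<i , minimum-one d m) least)
    where
    same-column : ∀ {c} → Column c → Related i c → c ≡ k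
    same-column d′ r′ = column-unique d′ d (transitive (symmetric r′) r)
    ¬column : ¬ Column i
    ¬column d′ = i≢k (same-column d′ (reflexive i))
    ¬top : ∀ {c} → ¬ Top c i
    ¬top t with refl ← same-column (row⇒column (top-col t)) (proj₁ (top-minimum t)) =
      i≢i₀ (just-injective (trans (sym t) (minimum-top d m)))
    i<k : i < k
    i<k = ℕₚ.≤∧≢⇒< (proj₂ d i (symmetric r)) (i≢k ∘ toℕ-injective)
    i₀<i : i₀ < i
    i₀<i = ℕₚ.≤∧≢⇒< (ℕₚ.≮⇒≥ λ i<i₀ → proj₂ m i i<i₀ r) (λ eq → i≢i₀ (sym (toℕ-injective eq)))
    ¬e : ¬ Entry i k
    ¬e e with entry⇒ e
    ... | _ , inj₁ (_ , least)   = least i₀ i₀<i (proj₁ m)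
    ... | _ , inj₂ (_ , ¬closed) = ¬closed (k , ℕₚ.≤-refl , d , r)
    least : ∀ {j} → j < k → ¬ Restricted i j
    least j<k (z , a) = let c , c≤j , d′ , r′ = zero-closed z a
                        in <⇒≢ (ℕₚ.≤-<-trans c≤j j<k) (same-column d′ r′)

  columnless-block : ∀ {i} → (∀ c → Column c → ¬ Related i c) → block i ≡ i
  columnless-block {i} ¬column = block-alone
    (λ {c} t → ¬column c (row⇒column (top-col t)) (proj₁ (top-minimum t)))
    (go (white-first i))
    where
    go : ∀ {m} → First (Restricted i) m → m ≡ nothing
    go (none _)          = refl
    go (first (z , a) _) = let c , _ , d , r = zero-closed z a in ⊥-elim (¬column c d r)

  block-related : ∀ i → Related i (block i)
  block-related i with any? (λ c → column? c ×-dec related? i c)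
  ... | yes (c , d , r) = subst (Related i) (sym (related-block-column d r)) r
  ... | no ¬column      = subst (Related i) (sym (columnless-block λ c d r → ¬column (c , d , r))) (reflexive i)

  related⇒same-block : ∀ {i j} → Related i j → block i ≡ block j
  related⇒same-block {i} {j} r with <-cmp i j
  ... | tri≈ _ refl _ = refl
  ... | tri< i<j _ _  = let c , d , r′ = column-above r i<j in
        trans (related-block-column d (transitive r r′)) (sym (related-block-column d r′))
  ... | tri> _ _ j<i  = let c , d , r′ = column-above (symmetric r) j<i in
        trans (related-block-column d r′) (sym (related-block-column d (transitive (symmetric r) r′)))

  partition≡ : partition ≡ M
  partition≡ = sym (tabulate²-lookup M λ i j → det (T-reflects _)
    (reflects-map (λ eq → transitive (block-related i) (subst (λ b → Related b j) (sym eq) (symmetric (block-related j))))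
                  related⇒same-block (==F-reflects (block i) (block j))))

-- Counting through the bijection

concatMap-map≡cartesianProductWith : {Y Z : Set} (f : X → Y → Z) (xs : List X) (ys : List Y) →
  concatMap (λ x → map (f x) ys) xs ≡ cartesianProductWith f xs ys
concatMap-map≡cartesianProductWith f []       ys = refl
concatMap-map≡cartesianProductWith f (x ∷ xs) ys = cong (map (f x) ys ++_) (concatMap-map≡cartesianProductWith f xs ys)

Enumerates : List X → Set
Enumerates xs = Unique xs × (∀ x → x ∈ xs)

product-enumerates : {Y Z : Set} (f : X → Y → Z) → (∀ {w x y z} → f w y ≡ f x z → w ≡ x × y ≡ z) →
  (∀ z → ∃ λ x → ∃ λ y → z ≡ f x y) → {xs : List X} {ys : List Y} →
  Enumerates xs → Enumerates ys → Enumerates (concatMap (λ x → map (f x) ys) xs)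
product-enumerates f inj surj {xs} {ys} (ux , cx) (uy , cy) =
  subst Enumerates (sym (concatMap-map≡cartesianProductWith f xs ys))
    ( Unique.cartesianProductWith⁺ f inj ux uy
    , λ z → let x , y , eq = surj z in
            subst (_∈ _) (sym eq) (∈-cartesianProductWith⁺ f (cx x) (cy y)))

allVecs-enumerates : {xs : List X} → Enumerates xs → ∀ n → Enumerates (allVecs xs n)
allVecs-enumerates e zero    = ([] ∷ []) , λ { Vec.[] → here refl }
allVecs-enumerates e (suc n) =
  product-enumerates Vec._∷_ ∷-injective (λ { (x Vec.∷ v) → x , v , refl }) e (allVecs-enumerates e n)

bools-enumerate : Enumerates (true ∷ false ∷ [])
bools-enumerate = (((λ ()) ∷ []) ∷ [] ∷ []) , λ { true → here refl ; false → there (here refl) }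

matrices : ∀ n → List (Vec (Vec Bool n) n)
matrices n = allVecs (allVecs (true ∷ false ∷ []) n) n

matrices-enumerate : ∀ n → Enumerates (matrices n)
matrices-enumerate n = allVecs-enumerates (allVecs-enumerates bools-enumerate n) n

candidates-enumerate : ∀ n → Enumerates (candidates n)
candidates-enumerate n = product-enumerates _,_ ,-injective (λ { (s , A) → s , A , refl })
  (allVecs-enumerates bools-enumerate n) (matrices-enumerate n)

-- As `g` undoes `f` on the selected elements, the image has no repetitions; two repetition-free
-- lists with the same members are permutations of each other.
filter-bijection-length : {Y : Set} {p : X → Bool} {q : Y → Bool} {xs : List X} {ys : List Y} →
  Enumerates xs → Enumerates ys → (f : X → Y) (g : Y → X) →
  (∀ x → T (p x) → T (q (f x)) × g (f x) ≡ x) → (∀ y → T (q y) → T (p (g y)) × f (g y) ≡ y) →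
  length (filterᵇ p xs) ≡ length (filterᵇ q ys)
filter-bijection-length {X} {Y} {p} {q} {xs} {ys} (ux , cx) (uy , cy) f g to from =
  trans (sym (length-map f (filterᵇ p xs)))
        (↭-length (∼bag⇒↭ (unique∧set⇒bag unique-image (Unique.filter⁺ (T? ∘ q) uy) same)))
  where
  ∈⇒ : ∀ {x} → x ∈ filterᵇ p xs → T (p x)
  ∈⇒ m = proj₂ (∈-filter⁻ (T? ∘ p) {xs = xs} m)

  unique-image : Unique (map f (filterᵇ p xs))
  unique-image = Unique.map⁻ {f = g} (subst Unique
    (trans (sym (map-id-local (All.tabulate λ m → proj₂ (to _ (∈⇒ m))))) (map-∘ (filterᵇ p xs)))
    (Unique.filter⁺ (T? ∘ p) ux))

  same : ∀ {y} → (y ∈ map f (filterᵇ p xs)) ⇔ (y ∈ filterᵇ q ys)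
  same {y} = mk⇔
    (λ m → let x , k , eq = ∈-map⁻ f m in
           ∈-filter⁺ (T? ∘ q) (cy y) (subst (T ∘ q) (sym eq) (proj₁ (to x (∈⇒ k)))))
    (λ m → let t , eq = from y (proj₂ (∈-filter⁻ (T? ∘ q) {xs = ys} m)) in
           subst (_∈ _) eq (∈-map⁺ f (∈-filter⁺ (T? ∘ p) (cx (g y)) t)))

theorem3p1 : (n : ℕ) → 1 ℕ.≤ n → numPermTableauxInv0 n ≡ bell n
theorem3p1 n _ = filter-bijection-length (candidates-enumerate n) (matrices-enumerate n)
  (λ (s , A) → Partition.partition s A) (λ M → Blocks.shape M , Blocks.filling M) to from
  where
  to : ∀ c → _ → _
  to (s , A) t =
    complete (Blocks.equivalence-reflects (Partition.partition s A)) (Partition.partition-equivalence s A) ,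
    (let eq₁ , eq₂ = Blocks.matches⇒≡ (Partition.partition s A) s A
                       (Partition.partition-matches s A v inj nest)
     in sym (cong₂ _,_ eq₁ eq₂))
    where
    split = sound (Diagram.valid-reflects s A ×-reflects T-reflects _) t
    v     = proj₁ split
    inj   = proj₁ (Paths.inv0⇒ s A v (proj₂ split))
    nest  = proj₂ (Paths.inv0⇒ s A v (proj₂ split))

  from : ∀ M → _ → _
  from M t = complete (Diagram.valid-reflects _ _ ×-reflects T-reflects _)
      (F.valid , Paths.inv0⇐ _ _ F.valid F.tops-injective F.nested) , F.partition≡
    where
    module F = FromEquivalence M (sound (Blocks.equivalence-reflects M) t) _ _ (Blocks.shape-filling-matches M)
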